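{- Permutation Pattern Matching can be solved in time $\mathcal{O}(n^{1+\mathsf{run}(P)})$, where $n$ is the length of the text $T$ and $P$ is the pattern.
   Context: For $m\in\mathbb{N}$, $[m]=\{1,\dots,m\}$; an $m$-permutation is a bijection $\pi:[m]\to[m]$, viewed as the sequence $\pi(1),\dots,\pi(m)$. Permutation Pattern Matching (PPM): Instance: an $n$-permutation $T$ (the text) and a $k$-permutation $P$ (the pattern) with $k\le n$. Question: is there a matching of $P$ into $T$, i.e., a monotonically (strictly) increasing map $M:[k]\to[n]$ such that the sequence $(M(P(1)),M(P(2)),\dots,M(P(k)))$ is a subsequence of $T$? Alternating runs: a valley of $\pi$ is an element $\pi(i)$ smaller than both of its neighbours, a peak is an element larger than both of its neighbours; for the first and last element only the existing neighbour is compared. Valleys and peaks are the local extrema; the first and last elements of $\pi$ are always local extrema. The first alternating run consists of the elements from the first element up to and including the second local extremum; the second run starts with the following element and ends with the third local extremum, and so on. Thus every element lies in exactly one run, and $\mathsf{run}(\pi)$, the number of alternating runs, satisfies: $\mathsf{run}(\pi)+1$ is the number of local extrema (so it is $0$ if $m=1$). Example: $53142$ has the three runs $531\,|\,4\,|\,2$. Running times refer to the random access machine (RAM) model in which elementary arithmetic operations (addition, subtraction, multiplication, modulo) take constant time. -}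

module Defs where

open import Data.Bool.Base using (true; false; if_then_else_)
open import Data.Fin.Base as Fin using (Fin; zero; suc; toℕ; fromℕ)
import Data.Fin.Properties as Fin
open import Data.Fin.Permutation using (Permutation′; _⟨$⟩ʳ_)
open import Data.List.Base
  using (List; []; _∷_; [_]; _++_; map; head; drop; tabulate; allFin; filter; length)
open import Data.List.Properties using (filter-accept)
open import Data.List.Relation.Binary.Sublist.Propositional using (_⊆_)
open import Data.Maybe.Base using (Maybe; just; nothing; fromMaybe)
open import Data.Nat.Base
open import Data.Nat.DivMod using (_%_)
open import Data.Nat.Properties using (_≟_; <-irrefl; suc-injective)
open import Data.Product.Base using (_×_; _,_; ∃-syntax)
open import Data.Sum.Base using (_⊎_; inj₁; inj₂)
open import Function.Base using (_∘_)
open import Function.Bundles using (Injection)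
open import Function.Properties.Inverse using (↔⇒↣)
open import Level using (0ℓ)
open import Relation.Binary.Core using (_Preserves_⟶_)
open import Relation.Binary.Definitions using (tri<; tri≈; tri>)
open import Relation.Binary.PropositionalEquality.Core
  using (_≡_; _≢_; refl; sym; trans; cong; subst)
open import Relation.Nullary using (¬_; Dec; yes; no; does; contradiction)
open import Relation.Nullary.Decidable using (_→-dec_; _⊎-dec_)
open import Relation.Unary using (Pred; Decidable)

------------------------------------------------------------------------
-- Permutations and alternating runs

-- The set {1, …, m} is Fin m, with i : Fin m standing for suc (toℕ i).

sequence : ∀ {m} → Permutation′ m → List (Fin m)
sequence π = tabulate (π ⟨$⟩ʳ_)

Neighbours : ∀ {m} → Fin m → Fin m → Set
Neighbours i j = toℕ j ≡ suc (toℕ i) ⊎ toℕ i ≡ suc (toℕ j)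

Valley Peak LocalExtremum : ∀ {m} → Permutation′ m → Pred (Fin m) 0ℓ
Valley π i = ∀ j → Neighbours i j → (π ⟨$⟩ʳ i) Fin.< (π ⟨$⟩ʳ j)
Peak   π i = ∀ j → Neighbours i j → (π ⟨$⟩ʳ j) Fin.< (π ⟨$⟩ʳ i)
LocalExtremum π i = Valley π i ⊎ Peak π i

neighbours? : ∀ {m} (i j : Fin m) → Dec (Neighbours i j)
neighbours? i j = (toℕ j ≟ suc (toℕ i)) ⊎-dec (toℕ i ≟ suc (toℕ j))

localExtremum? : ∀ {m} (π : Permutation′ m) → Decidable (LocalExtremum π)
localExtremum? π i =
  Fin.all? (λ j → neighbours? i j →-dec ((π ⟨$⟩ʳ i) Fin.<? (π ⟨$⟩ʳ j))) ⊎-dec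
  Fin.all? (λ j → neighbours? i j →-dec ((π ⟨$⟩ʳ j) Fin.<? (π ⟨$⟩ʳ i)))

localExtrema : ∀ {m} → Permutation′ m → List (Fin m)
localExtrema {m} π = filter (localExtremum? π) (allFin m)

-- Cuts a list into consecutive non-empty blocks, ending a block at each
-- element that satisfies P (and at the end of the list).
module _ {A : Set} {P : Pred A 0ℓ} (P? : Decidable P) where

  extend : A → List (List A) → List (List A)
  extend x []         = [ x ] ∷ []
  extend x (ys ∷ yss) = (x ∷ ys) ∷ yss

  splitAfter : List A → List (List A)
  splitAfter []       = []
  splitAfter (x ∷ xs) = if does (P? x) then [ x ] ∷ splitAfter xs
                                       else extend x (splitAfter xs)

addFirst : {A : Set} → A → List (List A) → List (List A)
addFirst x []         = []
addFirst x (ys ∷ yss) = (x ∷ ys) ∷ yss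

-- The alternating runs, as lists of positions.  The first element is a local
-- extremum that does not end a run, hence it is added to the block formed
-- after it.  For m = 1 there is no such block, and no run.
alternatingRuns : ∀ {m} → Permutation′ m → List (List (Fin m))
alternatingRuns {zero}  π = []
alternatingRuns {suc m} π = addFirst zero (splitAfter (localExtremum? π) (tabulate suc))

run : ∀ {m} → Permutation′ m → ℕ
run π = length (alternatingRuns π)

------------------------------------------------------------------------
-- Permutation Pattern Matching

record IsMatching {n k} (T : Permutation′ n) (P : Permutation′ k)
                  (M : Fin k → Fin n) : Set where
  field
    increasing  : M Preserves Fin._<_ ⟶ Fin._<_
    subsequence : map M (sequence P) ⊆ sequence T

record PPMInstance : Set where
  field
    n k : ℕ
    T   : Permutation′ n
    P   : Permutation′ k
    1≤k : 1 ≤ k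
    k≤n : k ≤ n

HasMatching : PPMInstance → Set
HasMatching I = ∃[ M ] IsMatching T P M
  where open PPMInstance I

------------------------------------------------------------------------
-- Random access machines

-- Registers are addressed directly by the program, memory cells only through
-- the contents of registers.  Both hold natural numbers; subtraction is
-- truncated at 0.

data ArithOp : Set where
  add sub mul mod : ArithOp

-- Totalised by a mod 0 = 0.
⟦_⟧ : ArithOp → ℕ → ℕ → ℕ
⟦ add ⟧ a b       = a + b
⟦ sub ⟧ a b       = a ∸ b
⟦ mul ⟧ a b       = a * b
⟦ mod ⟧ a zero    = 0
⟦ mod ⟧ a (suc b) = a % suc b

data Instr : Set where
  const : (d c : ℕ) → Instr                 -- R[d] := c
  arith : (d : ℕ) → ArithOp → (a b : ℕ) → Instr  -- R[d] := R[a] op R[b]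
  load  : (d a : ℕ) → Instr                 -- R[d] := Mem[R[a]]
  store : (a s : ℕ) → Instr                 -- Mem[R[a]] := R[s]
  jump  : (l : ℕ) → Instr
  jzero : (a l : ℕ) → Instr                 -- jump to l if R[a] = 0

Program : Set
Program = List Instr

record Config : Set where
  constructor config
  field
    pc  : ℕ
    reg : ℕ → ℕ
    mem : ℕ → ℕ
open Config public

_[_≔_] : (ℕ → ℕ) → ℕ → ℕ → (ℕ → ℕ)
(f [ a ≔ v ]) x = if x ≡ᵇ a then v else f x

execute : Instr → Config → Config
execute (const d c)      (config p r m) = config (suc p) (r [ d ≔ c ]) m
execute (arith d op a b) (config p r m) = config (suc p) (r [ d ≔ ⟦ op ⟧ (r a) (r b) ]) m
execute (load d a)       (config p r m) = config (suc p) (r [ d ≔ m (r a) ]) m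
execute (store a s)      (config p r m) = config (suc p) r (m [ r a ≔ r s ])
execute (jump l)         (config p r m) = config l r m
execute (jzero a l)      (config p r m) = config (if r a ≡ᵇ 0 then l else suc p) r m

fetch : Program → ℕ → Maybe Instr
fetch prog p = head (drop p prog)

-- prog ⊢ c ⇓⟨ t ⟩ c′: started in c, the machine halts in c′ after exactly t
-- unit-cost instructions.  It halts when the program counter leaves the program.
data _⊢_⇓⟨_⟩_ (prog : Program) : Config → ℕ → Config → Set where
  halt : ∀ {c} → fetch prog (pc c) ≡ nothing → prog ⊢ c ⇓⟨ 0 ⟩ c
  step : ∀ {c i t c′} → fetch prog (pc c) ≡ just i →
         prog ⊢ execute i c ⇓⟨ t ⟩ c′ → prog ⊢ c ⇓⟨ suc t ⟩ c′

------------------------------------------------------------------------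
-- Deciding Permutation Pattern Matching on a random access machine

values : ∀ {m} → Permutation′ m → List ℕ
values π = map (suc ∘ toℕ) (sequence π)

-- R[0] = n, R[1] = k, Mem[0 ..] = T(1), …, T(n), P(1), …, P(k); all else is 0.
input : PPMInstance → Config
input I = config 0 registers memory
  where
  open PPMInstance I

  registers : ℕ → ℕ
  registers 0 = n
  registers 1 = k
  registers _ = 0

  memory : ℕ → ℕ
  memory a = fromMaybe 0 (head (drop a (values T ++ values P)))

-- The answer is left in R[0]: 1 for yes, 0 for no.
Correct : PPMInstance → ℕ → Set
Correct I answer = (answer ≡ 1 × HasMatching I) ⊎ (answer ≡ 0 × ¬ HasMatching I)

SolvesWithin : Program → PPMInstance → ℕ → Set
SolvesWithin prog I bound =
  ∃[ t ] ∃[ c ] prog ⊢ input I ⇓⟨ t ⟩ c × t ≤ bound × Correct I (reg c 0)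

PPMSolvableInTimeO : (PPMInstance → ℕ) → Set
PPMSolvableInTimeO f = ∃[ prog ] ∃[ C ] (∀ I → SolvesWithin prog I (C * f I))

------------------------------------------------------------------------
-- run(π) + 1 is the number of local extrema

private

  Neighbour-first : ∀ {m} {j : Fin (2 + m)} → Neighbours zero j → j ≡ suc zero
  Neighbour-first (inj₁ eq) = Fin.toℕ-injective eq

  Neighbour-last : ∀ {m} {j : Fin (2 + m)} → Neighbours (fromℕ (suc m)) j →
                   j ≡ Fin.inject₁ (fromℕ m)
  Neighbour-last {m} {j} (inj₁ eq) = contradiction
    (subst (_< 2 + m) (trans eq (cong suc (Fin.toℕ-fromℕ (suc m)))) (Fin.toℕ<n j))
    (<-irrefl refl)
  Neighbour-last {m} (inj₂ eq) = Fin.toℕ-injective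
    (trans (sym (suc-injective eq)) (sym (Fin.toℕ-inject₁ (fromℕ m))))

  unique-neighbour : ∀ {m} (π : Permutation′ m) {i j} → i ≢ j →
                     (∀ {j′} → Neighbours i j′ → j′ ≡ j) → LocalExtremum π i
  unique-neighbour π {i} {j} i≢j only with Fin.<-cmp (π ⟨$⟩ʳ i) (π ⟨$⟩ʳ j)
  ... | tri< lt _ _ = inj₁ λ j′ nb → subst (λ x → (π ⟨$⟩ʳ i) Fin.< (π ⟨$⟩ʳ x)) (sym (only nb)) lt
  ... | tri≈ _ eq _ = contradiction (Injection.injective (↔⇒↣ π) eq) i≢j
  ... | tri> _ _ gt = inj₂ λ j′ nb → subst (λ x → (π ⟨$⟩ʳ x) Fin.< (π ⟨$⟩ʳ i)) (sym (only nb)) gt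

  length-addFirst : {A : Set} (x : A) (yss : List (List A)) → length (addFirst x yss) ≡ length yss
  length-addFirst x []      = refl
  length-addFirst x (_ ∷ _) = refl

  module _ {A : Set} {P : Pred A 0ℓ} (P? : Decidable P) where

    length-extend : ∀ x x′ xs → length (extend P? x (splitAfter P? (x′ ∷ xs))) ≡
                                length (splitAfter P? (x′ ∷ xs))
    length-extend x x′ xs with does (P? x′) | splitAfter P? xs
    ... | true  | _       = refl
    ... | false | []      = refl
    ... | false | _ ∷ _   = refl

    length-splitAfter : ∀ n (f : Fin (suc n) → A) → P (f (fromℕ n)) →
      length (splitAfter P? (tabulate f)) ≡ length (filter P? (tabulate f))
    length-splitAfter zero f p with P? (f zero)
    ... | yes _ = refl
    ... | no ¬p = contradiction p ¬p
    length-splitAfter (suc n) f p with P? (f zero)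
    ... | yes _ = cong suc (length-splitAfter n (f ∘ suc) p)
    ... | no  _ = trans (length-extend (f zero) (f (suc zero)) (tabulate λ i → f (suc (suc i))))
                        (length-splitAfter n (f ∘ suc) p)

run-localExtrema : ∀ {m} (π : Permutation′ (suc m)) → suc (run π) ≡ length (localExtrema π)
run-localExtrema {zero} π =
  sym (cong length (filter-accept (localExtremum? π) {xs = []} first-extremum))
  where
  first-extremum : LocalExtremum π zero
  first-extremum = inj₁ λ { zero (inj₁ ()) ; zero (inj₂ ()) }
run-localExtrema {suc m} π = trans
  (cong suc (trans (length-addFirst zero (splitAfter (localExtremum? π) (tabulate suc)))
                   (length-splitAfter (localExtremum? π) m suc last-extremum)))
  (sym (cong length (filter-accept (localExtremum? π) {xs = tabulate suc} first-extremum)))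
  where
  first-extremum : LocalExtremum π zero
  first-extremum = unique-neighbour π (λ ()) Neighbour-first

  last-extremum : LocalExtremum π (fromℕ (suc m))
  last-extremum = unique-neighbour π Fin.fromℕ≢inject₁ Neighbour-last

-- The pattern elements are placed into the text in order of increasing value.
-- Within an alternating run the elements placed so far are consecutive, so the
-- only constraint on the next element of the run is that its text position lies
-- beyond that of the last one: one text position per run describes all that
-- matters of a partial matching, except for the text value used last, which a
-- table over the n ^ run P tuples of positions minimises.  To place an element,
-- the table is first replaced by its running minimum along the coordinate of the
-- run of that element, which takes constant time per entry.
--
-- The constraints at the ends of the runs become one uniform test.  Until its
-- first element is placed, the coordinate of a run is a guess that nothing else
-- depends on; when an element is placed, its position is compared with the
-- coordinate of the run that contains the edge to its right.  If the element is
-- the last of its run and a valley, this checks the guess for the ascending run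
-- that starts there; if it is a peak, this checks the descending run that ends
-- there.  Only weak inequalities are tested, since increasing text values make
-- the positions distinct.
module Submission where

open import Defs
open import Data.Bool.Base using (true; false; if_then_else_)
open import Data.Fin.Base as Fin using (Fin; zero; suc; toℕ; fromℕ<)
open import Data.Fin.Permutation using (Permutation′; _⟨$⟩ʳ_; _⟨$⟩ˡ_; inverseˡ; inverseʳ)
import Data.Fin.Properties as Fin
open import Data.List.Base
  using (List; []; _∷_; _++_; map; head; drop; tabulate; allFin; filter; length)
open import Data.List.Properties
  using (length-++; map-tabulate; tabulate-cong; ++-identityʳ; filter-accept)
open import Data.List.Relation.Binary.Sublist.Propositional
  using (_⊆_; []; _∷_; _∷ʳ_) renaming (minimum to []⊆)
open import Data.Maybe.Base using (just; nothing; fromMaybe)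
open import Data.Nat.Base
open import Data.Nat.DivMod hiding (_mod_)
open import Data.Nat.Properties
open import Data.Nat.Tactic.RingSolver using (solve-∀)
open import Data.Product.Base using (_×_; _,_; ∃-syntax; proj₁; proj₂)
open import Data.Sum.Base using (_⊎_; inj₁; inj₂)
open import Function.Base using (_∘_)
open import Function.Bundles using (Injection)
open import Function.Properties.Inverse using (↔⇒↣)
open import Level using (0ℓ)
open import Relation.Binary.Core using (_Preserves_⟶_)
open import Relation.Binary.Definitions using (tri<; tri≈; tri>)
open import Relation.Binary.PropositionalEquality
open import Relation.Nullary using (¬_; yes; no; contradiction)
open import Relation.Unary using (Pred; Decidable)

-- A structured language for the random access machine

Memory : Set
Memory = ℕ → ℕ

data Basic : Set where
  const : (d c : ℕ) → Basic
  arith : (d : ℕ) → ArithOp → (a b : ℕ) → Basic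
  load  : (d a : ℕ) → Basic
  store : (a s : ℕ) → Basic

instr : Basic → Instr
instr (const d c)      = const d c
instr (arith d op a b) = arith d op a b
instr (load d a)       = load d a
instr (store a s)      = store a s

regAfter : List Basic → Memory → Memory → Memory
memAfter : List Basic → Memory → Memory → Memory
regAfter []                     r m = r
regAfter (const d c ∷ bs)       r m = regAfter bs (r [ d ≔ c ]) m
regAfter (arith d op a b ∷ bs)  r m = regAfter bs (r [ d ≔ ⟦ op ⟧ (r a) (r b) ]) m
regAfter (load d a ∷ bs)        r m = regAfter bs (r [ d ≔ m (r a) ]) m
regAfter (store a s ∷ bs)       r m = regAfter bs r (m [ r a ≔ r s ])
memAfter []                     r m = m
memAfter (const d c ∷ bs)       r m = memAfter bs (r [ d ≔ c ]) m
memAfter (arith d op a b ∷ bs)  r m = memAfter bs (r [ d ≔ ⟦ op ⟧ (r a) (r b) ]) m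
memAfter (load d a ∷ bs)        r m = memAfter bs (r [ d ≔ m (r a) ]) m
memAfter (store a s ∷ bs)       r m = memAfter bs r (m [ r a ≔ r s ])

infixr 5 _⨾_

data Cmd : Set where
  block : List Basic → Cmd
  _⨾_   : Cmd → Cmd → Cmd
  while : ℕ → Cmd → Cmd

size : Cmd → ℕ
size (block bs)  = length bs
size (c ⨾ d)     = size c + size d
size (while a c) = suc (size c + 1)

compileBlock : List Basic → Program
compileBlock []       = []
compileBlock (b ∷ bs) = instr b ∷ compileBlock bs

compile : ℕ → Cmd → Program
compile p (block bs)  = compileBlock bs
compile p (c ⨾ d)     = compile p c ++ compile (p + size c) d
compile p (while a c) =
  jzero a (p + size (while a c)) ∷ compile (suc p) c ++ jump p ∷ []

length-compile : ∀ p c → length (compile p c) ≡ size c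
length-compile p (block bs) = go bs
  where
  go : ∀ bs → length (compileBlock bs) ≡ length bs
  go []       = refl
  go (b ∷ bs) = cong suc (go bs)
length-compile p (c ⨾ d) = trans (length-++ (compile p c))
  (cong₂ _+_ (length-compile p c) (length-compile (p + size c) d))
length-compile p (while a c) = cong suc (trans (length-++ (compile (suc p) c))
  (cong (_+ 1) (length-compile (suc p) c)))

-- Stated through `fetch`, so that a piece of code can be located without mentioning what surrounds
-- it in the program.
record Loaded (prog : Program) (p : ℕ) (code : Program) : Set where
  constructor loaded
  field
    fetched : ∀ i {x} → fetch code i ≡ just x → fetch prog (p + i) ≡ just x
open Loaded

fetch-++ˡ : ∀ xs {ys i x} → fetch xs i ≡ just x → fetch (xs ++ ys) i ≡ just x
fetch-++ˡ []       {i = zero}  ()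
fetch-++ˡ []       {i = suc i} ()
fetch-++ˡ (y ∷ xs) {i = zero}  eq = eq
fetch-++ˡ (y ∷ xs) {i = suc i} eq = fetch-++ˡ xs {i = i} eq

fetch-++ʳ : ∀ xs {ys} i → fetch (xs ++ ys) (length xs + i) ≡ fetch ys i
fetch-++ʳ []       i = refl
fetch-++ʳ (x ∷ xs) i = fetch-++ʳ xs i

fetch-length : ∀ xs → fetch xs (length xs) ≡ nothing
fetch-length []       = refl
fetch-length (x ∷ xs) = fetch-length xs

loaded-head : ∀ {prog p x xs} → Loaded prog p (x ∷ xs) → fetch prog p ≡ just x
loaded-head {prog} {p} {x} l =
  subst (λ q → fetch prog q ≡ just x) (+-identityʳ p) (fetched l 0 refl)

loaded-tail : ∀ {prog p x xs} → Loaded prog p (x ∷ xs) → Loaded prog (suc p) xs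
loaded-tail {prog} {p} l = loaded λ i {y} eq →
  subst (λ q → fetch prog q ≡ just y) (+-suc p i) (fetched l (suc i) eq)

loaded-++ˡ : ∀ {prog p} xs {ys} → Loaded prog p (xs ++ ys) → Loaded prog p xs
loaded-++ˡ xs l = loaded λ i eq → fetched l i (fetch-++ˡ xs {i = i} eq)

loaded-++ʳ : ∀ {prog p} xs {ys} → Loaded prog p (xs ++ ys) → Loaded prog (p + length xs) ys
loaded-++ʳ {prog} {p} xs l = loaded λ i {y} eq →
  subst (λ q → fetch prog q ≡ just y) (sym (+-assoc p (length xs) i))
    (fetched l (length xs + i) (trans (fetch-++ʳ xs i) eq))

-- In continuation form: a halting run from the state after c extends to one
-- from the state before c, so that consecutive pieces of code compose.
record Runs (c : Cmd) (r m : Memory) (t : ℕ) (r′ m′ : Memory) : Set where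
  constructor runs
  field
    extendRun : ∀ {prog p} → Loaded prog p (compile p c) → ∀ {t′ final} →
      prog ⊢ config (p + size c) r′ m′ ⇓⟨ t′ ⟩ final → prog ⊢ config p r m ⇓⟨ t + t′ ⟩ final
open Runs

runs-block : ∀ bs {r m} → Runs (block bs) r m (length bs) (regAfter bs r m) (memAfter bs r m)
runs-block [] {r} {m} = runs λ {prog} {p} l {t′} {final} halts →
  subst (λ q → prog ⊢ config q r m ⇓⟨ t′ ⟩ final) (+-identityʳ p) halts
runs-block (b ∷ bs) {r} {m} = runs λ {prog} {p} l {t′} {final} halts →
  step (loaded-head l) (first b (loaded-tail l) halts)
  where
  first : ∀ b {prog p t′ final} → Loaded prog (suc p) (compileBlock bs) →
    prog ⊢ config (p + suc (length bs)) (regAfter (b ∷ bs) r m) (memAfter (b ∷ bs) r m) ⇓⟨ t′ ⟩ final →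
    prog ⊢ execute (instr b) (config p r m) ⇓⟨ length bs + t′ ⟩ final
  first b {p = p} l halts rewrite +-suc p (length bs) with b
  ... | const d c      = extendRun (runs-block bs) l halts
  ... | arith d op x y = extendRun (runs-block bs) l halts
  ... | load d x       = extendRun (runs-block bs) l halts
  ... | store x s      = extendRun (runs-block bs) l halts

runs-⨾ : ∀ c d {r m t r′ m′ u r″ m″} → Runs c r m t r′ m′ → Runs d r′ m′ u r″ m″ →
         Runs (c ⨾ d) r m (t + u) r″ m″
runs-⨾ c d {r} {m} {t} {r′} {m′} {u} {r″} {m″} first second =
  runs λ {prog} {p} l {t′} {final} halts →
    subst (λ q → prog ⊢ config p r m ⇓⟨ q ⟩ final) (sym (+-assoc t u t′))
      (extendRun first (loaded-++ˡ (compile p c) l)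
        (extendRun second
          (subst (λ q → Loaded prog (p + q) (compile (p + size c) d)) (length-compile p c)
                (loaded-++ʳ (compile p c) l))
          (subst (λ q → prog ⊢ config q r″ m″ ⇓⟨ t′ ⟩ final) (sym (+-assoc p (size c) (size d)))
                 halts)))

runs-while-zero : ∀ a c {r m} → r a ≡ 0 → Runs (while a c) r m 1 r m
runs-while-zero a c {r} {m} ra≡0 = runs λ {prog} {p} l {t′} {final} halts →
  step (loaded-head l)
    (subst (λ q → prog ⊢ config q r m ⇓⟨ t′ ⟩ final) (sym (leave ra≡0)) halts)
  where
  leave : ∀ {x p} → x ≡ 0 → (if x ≡ᵇ 0 then p + size (while a c) else suc p) ≡ p + size (while a c)
  leave refl = refl

runs-while-suc : ∀ a c {r m x t r′ m′ u r″ m″} → r a ≡ suc x → Runs c r m t r′ m′ →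
  Runs (while a c) r′ m′ u r″ m″ → Runs (while a c) r m (suc (t + suc u)) r″ m″
runs-while-suc a c {r} {m} {x} {t} {u = u} ra≡1+x body rest =
  runs λ {prog} {p} l {t′} {final} halts →
    let body-loaded = loaded-tail l in
    step (loaded-head l)
      (subst₂ (λ q s → prog ⊢ config q r m ⇓⟨ s ⟩ final) (sym (enter ra≡1+x))
              (sym (+-assoc t (suc u) t′))
        (extendRun body (loaded-++ˡ (compile (suc p) c) body-loaded)
          (step {i = jump p} (loaded-head
                  (subst (λ q → Loaded prog (suc p + q) (jump p ∷ [])) (length-compile (suc p) c)
                    (loaded-++ʳ (compile (suc p) c) body-loaded)))
            (extendRun rest l halts))))
  where
  enter : ∀ {y p} → y ≡ suc x → (if y ≡ᵇ 0 then p + size (while a c) else suc p) ≡ suc p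
  enter refl = refl

-- Total correctness with an exact time that is the same for all initial states: blocks contain no
-- jumps, and each loop runs a number of rounds fixed in advance.
record _⊢_⟨_⟩_ (Pre : Memory → Memory → Set) (c : Cmd) (t : ℕ) (Post : Memory → Memory → Set) : Set where
  constructor triple
  field
    establish : ∀ {r m} → Pre r m → ∃[ r′ ] ∃[ m′ ] Runs c r m t r′ m′ × Post r′ m′
open _⊢_⟨_⟩_

⊢-⨾ : ∀ {Pre Mid Post c d t u} → Pre ⊢ c ⟨ t ⟩ Mid → Mid ⊢ d ⟨ u ⟩ Post →
      Pre ⊢ c ⨾ d ⟨ t + u ⟩ Post
⊢-⨾ {c = c} {d} first second = triple λ pre →
  let r′ , m′ , runs₁ , mid  = establish first pre
      r″ , m″ , runs₂ , post = establish second mid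
  in  r″ , m″ , runs-⨾ c d runs₁ runs₂ , post

⊢-block : ∀ {Pre Post : Memory → Memory → Set} bs →
          (∀ {r m} → Pre r m → Post (regAfter bs r m) (memAfter bs r m)) →
          Pre ⊢ block bs ⟨ length bs ⟩ Post
⊢-block bs f = triple λ pre → _ , _ , runs-block bs , f pre

-- A round costs the body plus the test and the jump back, hence `2 + t`; the test that leaves the
-- loop costs the final 1.
⊢-while : ∀ {Inv : ℕ → Memory → Memory → Set} {a c t} N →
          (∀ {i r m} → Inv i r m → r a ≡ N ∸ i) →
          (∀ {i} → i < N → Inv i ⊢ c ⟨ t ⟩ Inv (suc i)) →
          Inv 0 ⊢ while a c ⟨ N * (2 + t) + 1 ⟩ Inv N
⊢-while {Inv} {a} {c} {t} N counter body = go N 0 refl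
  where
  go : ∀ j i → i + j ≡ N → Inv i ⊢ while a c ⟨ j * (2 + t) + 1 ⟩ Inv N
  go zero i i+0≡N with trans (sym (+-identityʳ i)) i+0≡N
  ... | refl = triple λ {r} {m} inv →
    r , m , runs-while-zero a c (trans (counter inv) (n∸n≡0 i)) , inv
  go (suc j) i i+1+j≡N = triple λ {r} {m} inv →
    let r′ , m′ , runs₁ , inv′ = establish (body i<N) inv
        r″ , m″ , runs₂ , inv″ = establish (go j (suc i) (trans (sym (+-suc i j)) i+1+j≡N)) inv′
        positive = trans (counter inv) (trans (cong (_∸ i) (sym i+1+j≡N)) (m+n∸m≡n i (suc j)))
    in  r″ , m″ , subst (λ s → Runs (while a c) r m s r″ m″) time
                    (runs-while-suc a c positive runs₁ runs₂) , inv″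
    where
    i<N : i < N
    i<N = subst (i <_) i+1+j≡N (subst (i <_) (sym (+-suc i j)) (s≤s (m≤m+n i j)))
    time : suc (t + suc (j * (2 + t) + 1)) ≡ suc j * (2 + t) + 1
    time = cong suc (trans (+-suc t _) (cong suc (sym (+-assoc t (j * (2 + t)) 1))))

-- Digits in base n

module Digits (n : ℕ) .{{n≢0 : NonZero n}} where

  digit : ℕ → ℕ → ℕ
  digit zero    x = x % n
  digit (suc j) x = digit j (x / n)

  digit<n : ∀ j x → digit j x < n
  digit<n zero    x = m%n<n x n
  digit<n (suc j) x = digit<n j (x / n)

  digit-of-0 : ∀ j → digit j 0 ≡ 0
  digit-of-0 zero    = m<n⇒m%n≡m (>-nonZero⁻¹ n)
  digit-of-0 (suc j) = trans (cong (digit j) (0/n≡0 n)) (digit-of-0 j)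

  digit-/ : ∀ j x .{{_ : NonZero (n ^ j)}} → digit j x ≡ x / n ^ j % n
  digit-/ zero    x = cong (_% n) (sym (n/1≡n x))
  digit-/ (suc j) x = trans (digit-/ j (x / n) {{m^n≢0 n j}})
    (cong (_% n) (m/n/o≡m/[n*o] x n (n ^ j) {{n≢0}} {{m^n≢0 n j}}))

  private
    quotient : ∀ {d} q → d < n → (d + q * n) / n ≡ q
    quotient {d} q d<n = trans (+-distrib-/ d (q * n) small)
      (cong₂ _+_ (m<n⇒m/n≡0 d<n) (m*n/n≡m q n))
      where
      small : d % n + (q * n) % n < n
      small = subst (_< n) (sym (trans (cong₂ _+_ (m<n⇒m%n≡m d<n) (m*n%n≡0 q n)) (+-identityʳ d))) d<n

    remainder : ∀ {d} q → d < n → (d + q * n) % n ≡ d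
    remainder {d} q d<n = trans ([m+kn]%n≡m%n d q n) (m<n⇒m%n≡m d<n)

    recompose-< : ∀ {R d} q → d < n → q < n ^ R → d + q * n < n ^ suc R
    recompose-< {R} {d} q d<n q<n^R = ≤-trans (+-monoˡ-< (q * n) d<n)
      (subst (suc q * n ≤_) (*-comm (n ^ R) n) (*-monoˡ-≤ n q<n^R))

  fromDigits : ∀ R (f : ℕ → ℕ) → (∀ {j} → j < R → f j < n) →
               ∃[ x ] x < n ^ R × (∀ {j} → j < R → digit j x ≡ f j)
  fromDigits zero    f f<n = 0 , s≤s z≤n , λ ()
  fromDigits (suc R) f f<n with fromDigits R (λ j → f (suc j)) (λ j<R → f<n (s≤s j<R))
  ... | y , y<n^R , digits-y =
    f 0 + y * n , recompose-< {R} y (f<n (s≤s z≤n)) y<n^R , λ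
      { {zero}  _ → remainder y (f<n (s≤s z≤n))
      ; {suc j} (s≤s j<R) → trans (cong (digit j) (quotient y (f<n (s≤s z≤n)))) (digits-y j<R) }

  -- As the digit is positive, subtracting the stride causes no borrow. This moves a frontier one
  -- step back.
  decrement : ∀ c {x d} → digit c x ≡ suc d →
    ∃[ y ] x ≡ y + n ^ c × digit c y ≡ d × (∀ {j} → j ≢ c → digit j y ≡ digit j x)
  decrement zero {x} {d} eq = d + x / n * n
    , trans (m≡m%n+[m/n]*n x n) (trans (cong (_+ x / n * n) eq) (+-comm 1 _))
    , remainder (x / n) d<n
    , λ { {zero} 0≢0 → contradiction refl 0≢0 ; {suc j} _ → cong (digit j) (quotient (x / n) d<n) }
    where
    d<n : d < n
    d<n = <-trans (n<1+n d) (subst (_< n) eq (m%n<n x n))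
  decrement (suc c) {x} eq with decrement c {x / n} eq
  ... | y , x/n≡y+n^c , eq-c , eq-other = x % n + y * n
    , trans (trans (m≡m%n+[m/n]*n x n) (cong (λ q → x % n + q * n) x/n≡y+n^c))
            (shift (x % n) y (n ^ c) n)
    , trans (cong (digit c) (quotient y (m%n<n x n))) eq-c
    , λ { {zero} _ → remainder y (m%n<n x n)
        ; {suc j} j≢c → trans (cong (digit j) (quotient y (m%n<n x n)))
                              (eq-other (λ j≡c → j≢c (cong suc j≡c))) }
    where
    shift : ∀ a y p n → a + (y + p) * n ≡ a + y * n + n * p
    shift = solve-∀

  -- No carry arises, since the digit stays below `n`; for the same reason the index stays inside
  -- the table.
  increment : ∀ c {R x} → c < R → x < n ^ R → suc (digit c x) < n →
    x + n ^ c < n ^ R × digit c (x + n ^ c) ≡ suc (digit c x) ×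
    (∀ {j} → j ≢ c → digit j (x + n ^ c) ≡ digit j x)
  increment zero {suc R} {x} _ x<N 1+d<n =
      subst (_< n ^ suc R) (sym split) (recompose-< {R} (x / n) 1+d<n (m<n*o⇒m/o<n (subst (x <_) (*-comm n (n ^ R)) x<N)))
    , trans (cong (_% n) split) (remainder (x / n) 1+d<n)
    , λ { {zero} 0≢0 → contradiction refl 0≢0
        ; {suc j} _ → cong (digit j) (trans (cong (_/ n) split) (quotient (x / n) 1+d<n)) }
    where
    split : x + 1 ≡ suc (x % n) + x / n * n
    split = trans (+-comm x 1) (cong suc (m≡m%n+[m/n]*n x n))
  increment (suc c) {suc R} {x} (s≤s c<R) x<N 1+d<n
    with increment c {R} {x / n} c<R (m<n*o⇒m/o<n (subst (x <_) (*-comm n (n ^ R)) x<N)) 1+d<n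
  ... | below , eq-c , eq-other =
      subst (_< n ^ suc R) (sym split) (recompose-< {R} (x / n + n ^ c) (m%n<n x n) below)
    , trans (cong (digit c) high) eq-c
    , λ { {zero} _ → trans (cong (_% n) split) (remainder (x / n + n ^ c) (m%n<n x n))
        ; {suc j} j≢c → trans (cong (digit j) high) (eq-other (λ j≡c → j≢c (cong suc j≡c))) }
    where
    shift : ∀ a y p n → a + y * n + n * p ≡ a + (y + p) * n
    shift = solve-∀
    split : x + n ^ suc c ≡ x % n + (x / n + n ^ c) * n
    split = trans (cong (_+ n ^ suc c) (m≡m%n+[m/n]*n x n)) (shift (x % n) (x / n) (n ^ c) n)
    high : (x + n ^ suc c) / n ≡ x / n + n ^ c
    high = trans (cong (_/ n) split) (quotient (x / n + n ^ c) (m%n<n x n))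

⟦mod⟧-% : ∀ a b .{{_ : NonZero b}} → ⟦ mod ⟧ a b ≡ a % b
⟦mod⟧-% a (suc b) = refl

-- `1 ∸ suc x % s` is the indicator of `s` dividing `suc x`, which is when the quotient grows. It
-- allows a digit to be followed without division.
suc-/ : ∀ x s .{{_ : NonZero s}} → suc x / s ≡ x / s + (1 ∸ suc x % s)
suc-/ x s with suc (x % s) ≟ s
... | yes full = trans (cong (_/ s) exact) (trans (m*n/n≡m (suc (x / s)) s)
        (trans (+-comm 1 (x / s)) (cong (x / s +_) (cong (1 ∸_) (sym zero-remainder)))))
  where
  exact : suc x ≡ suc (x / s) * s
  exact = trans (cong suc (m≡m%n+[m/n]*n x s)) (cong (_+ x / s * s) full)
  zero-remainder : suc x % s ≡ 0
  zero-remainder = trans (cong (_% s) exact) (m*n%n≡0 (suc (x / s)) s)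
... | no ¬full = trans (cong (_/ s) split) (trans quot (trans (sym (+-identityʳ (x / s)))
        (cong (x / s +_) (trans (sym (0∸n≡0 (x % s))) (cong (1 ∸_) (sym positive-remainder))))))
  where
  below : suc (x % s) < s
  below = ≤∧≢⇒< (m%n<n x s) ¬full
  split : suc x ≡ suc (x % s) + x / s * s
  split = cong suc (m≡m%n+[m/n]*n x s)
  positive-remainder : suc x % s ≡ suc (x % s)
  positive-remainder = trans (cong (_% s) split)
    (trans ([m+kn]%n≡m%n (suc (x % s)) (x / s) s) (m<n⇒m%n≡m below))
  quot : (suc (x % s) + x / s * s) / s ≡ x / s
  quot = trans (+-distrib-/ (suc (x % s)) (x / s * s)
           (subst (_< s) (sym (trans (cong₂ _+_ (m<n⇒m%n≡m below) (m*n%n≡0 (x / s) s))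
             (+-identityʳ _))) below))
         (cong₂ _+_ (m<n⇒m/n≡0 below) (m*n/n≡m (x / s) s))

-- Slots of a pattern

≔-same : ∀ (f : ℕ → ℕ) a v → (f [ a ≔ v ]) a ≡ v
≔-same f a v with a ≡ᵇ a | ≡⇒≡ᵇ a a refl
... | true | _ = refl

≔-other : ∀ (f : ℕ → ℕ) {a} v {x} → x ≢ a → (f [ a ≔ v ]) x ≡ f x
≔-other f {a} v {x} x≢a with x ≡ᵇ a | ≡ᵇ⇒≡ x a
... | true  | sound = contradiction (sound _) x≢a
... | false | _     = refl

∸-min : ∀ a b → (a ≤ b × a ∸ (a ∸ b) ≡ a) ⊎ (b ≤ a × a ∸ (a ∸ b) ≡ b)
∸-min a b with ≤-total a b
... | inj₁ a≤b = inj₁ (a≤b , cong (a ∸_) (m≤n⇒m∸n≡0 a≤b))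
... | inj₂ b≤a = inj₂ (b≤a , m∸[m∸n]≡n b≤a)

∸-min-≤ˡ : ∀ a b → a ∸ (a ∸ b) ≤ a
∸-min-≤ˡ a b = m∸n≤m a (a ∸ b)

∸-min-≤ʳ : ∀ a b → a ∸ (a ∸ b) ≤ b
∸-min-≤ʳ a b with ∸-min a b
... | inj₁ (a≤b , eq) = subst (_≤ b) (sym eq) a≤b
... | inj₂ (_ , eq)   = ≤-reflexive eq

IsBit : ℕ → Set
IsBit b = b ≡ 0 ⊎ b ≡ 1

%2-isBit : ∀ a → IsBit (a % 2)
%2-isBit a with a % 2 | m%n<n a 2
... | 0           | _             = inj₁ refl
... | 1           | _             = inj₂ refl
... | suc (suc _) | s≤s (s≤s ())

0≢1 : ∀ {b} → b ≡ 0 → b ≡ 1 → ∀ {A : Set} → A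
0≢1 refl ()

-- Slot 0, 1, … are the alternating runs of the pattern, given by the values
-- P 0, …, P (k ∸ 1); the edge between positions i and suc i belongs to slot
-- (suc i), whose direction is 1 for an ascending and 0 for a descending run.
-- All formulas are free of case distinctions, so that the machine evaluates
-- them without jumps: 1 ∸ (1 ∸ a) is the sign of a, and a ∸ (a ∸ b) the minimum
-- of a and b.  The last argument k ∸ suc i of the minimum in change suppresses
-- a change of slot at the last position, which has no edge to its right.
module Slots (k : ℕ) (P : ℕ → ℕ) where

  rising : ℕ → ℕ
  rising i = 1 ∸ (1 ∸ (P (suc i) ∸ P i))

  -- Successive runs alternate, so the parity of the slot number, offset by the direction of the
  -- first edge, decides.
  direction : ℕ → ℕ
  direction j = (rising 0 + j) % 2

  change : ℕ → ℕ → ℕ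
  change d i = (d + rising i) % 2 ∸ ((d + rising i) % 2 ∸ (k ∸ suc i))

  slot : ℕ → ℕ
  slot zero    = 0
  slot (suc i) = slot i + change (direction (slot i)) i

  turn : ℕ → ℕ
  turn i = change (direction (slot i)) i

  rising-isBit : ∀ i → IsBit (rising i)
  rising-isBit i with P (suc i) ∸ P i
  ... | zero  = inj₁ refl
  ... | suc d = inj₂ (cong (1 ∸_) (0∸n≡0 d))

  rising-< : ∀ {i} → P i < P (suc i) → rising i ≡ 1
  rising-< {i} lt with P (suc i) ∸ P i | m<n⇒0<n∸m lt
  ... | suc d | _ = cong (1 ∸_) (0∸n≡0 d)

  rising-≥ : ∀ {i} → P (suc i) ≤ P i → rising i ≡ 0
  rising-≥ ge = cong (λ d → 1 ∸ (1 ∸ d)) (m≤n⇒m∸n≡0 ge)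

  rising≡1⇒< : ∀ {i} → rising i ≡ 1 → P i < P (suc i)
  rising≡1⇒< {i} eq with P i <? P (suc i)
  ... | yes lt = lt
  ... | no ¬lt = 0≢1 (rising-≥ (≮⇒≥ ¬lt)) eq

  rising≡0⇒≥ : ∀ {i} → rising i ≡ 0 → P (suc i) ≤ P i
  rising≡0⇒≥ {i} eq with P i <? P (suc i)
  ... | yes lt = 0≢1 eq (rising-< lt)
  ... | no ¬lt = ≮⇒≥ ¬lt

  direction-isBit : ∀ j → IsBit (direction j)
  direction-isBit j = %2-isBit (rising 0 + j)

  -- Lets the direction of a later slot be computed from that of the current one without the slot
  -- number, as the machine does with `$d`.
  direction-+ : ∀ j e → direction (j + e) ≡ (direction j + e) % 2
  direction-+ j e = trans (cong (_% 2) (sym (+-assoc (rising 0) j e)))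
    (trans (%-distribˡ-+ (rising 0 + j) e 2)
      (sym (trans (%-distribˡ-+ (direction j) e 2)
        (cong (λ d → (d + e % 2) % 2) (m%n%n≡m%n (rising 0 + j) 2)))))

  change-isBit : ∀ d i → IsBit (change d i)
  change-isBit d i with %2-isBit (d + rising i)
  ... | inj₁ eq = inj₁ (n≤0⇒n≡0 (≤-trans (∸-min-≤ˡ _ (k ∸ suc i)) (≤-reflexive eq)))
  ... | inj₂ eq with change d i | ≤-trans (∸-min-≤ˡ ((d + rising i) % 2) (k ∸ suc i)) (≤-reflexive eq)
  ...   | 0 | _ = inj₁ refl
  ...   | 1 | _ = inj₂ refl
  ...   | suc (suc _) | s≤s ()

  change-inner : ∀ {d i} → suc i < k → change d i ≡ (d + rising i) % 2
  change-inner {d} {i} 1+i<k with ∸-min ((d + rising i) % 2) (k ∸ suc i)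
  ... | inj₁ (_ , eq) = eq
  ... | inj₂ (≤bit , eq) = trans eq (≤-antisym ≤bit (≤-trans (bit≤1 (%2-isBit (d + rising i))) (m<n⇒0<n∸m 1+i<k)))
    where
    bit≤1 : ∀ {b} → IsBit b → b ≤ 1
    bit≤1 (inj₁ refl) = z≤n
    bit≤1 (inj₂ refl) = ≤-refl

  slot-last : ∀ {i} → k ≤ suc i → slot (suc i) ≡ slot i
  slot-last {i} k≤1+i = trans
    (cong (λ z → slot i + (y ∸ (y ∸ z))) (m≤n⇒m∸n≡0 k≤1+i))
    (trans (cong (slot i +_) (n∸n≡0 y)) (+-identityʳ (slot i)))
    where
    y = (direction (slot i) + rising i) % 2

  -- The slot number rises by the exclusive or of the old direction and that of the edge to the
  -- right; adding this bit to the old direction modulo 2 leaves the direction of the edge.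
  direction-slot : ∀ {i} → suc i < k → direction (slot (suc i)) ≡ rising i
  direction-slot {i} 1+i<k = trans
    (direction-+ (slot i) (change (direction (slot i)) i))
    (trans (cong (λ e → (direction (slot i) + e) % 2) (change-inner {direction (slot i)} 1+i<k))
      (bits (direction-isBit (slot i)) (rising-isBit i)))
    where
    bits : ∀ {a b} → IsBit a → IsBit b → (a + (a + b) % 2) % 2 ≡ b
    bits (inj₁ refl) (inj₁ refl) = refl
    bits (inj₁ refl) (inj₂ refl) = refl
    bits (inj₂ refl) (inj₁ refl) = refl
    bits (inj₂ refl) (inj₂ refl) = refl

  slot-mono : ∀ {i j} → i ≤ j → slot i ≤ slot j
  slot-mono i≤j = go (≤⇒≤′ i≤j)
    where
    go : ∀ {i j} → i ≤′ j → slot i ≤ slot j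
    go (≤′-reflexive refl) = ≤-refl
    go (≤′-step i≤j)       = ≤-trans (go i≤j) (m≤m+n _ _)

  -- Slot numbers never fall, so all positions in between share the slot, and by `direction-slot`
  -- every edge between them has its direction.
  same-slot : ∀ {i j} → i ≤ j → j < k → slot i ≡ slot j →
              (direction (slot i) ≡ 1 → P i ≤ P j) × (direction (slot i) ≡ 0 → P j ≤ P i)
  same-slot i≤j = go (≤⇒≤′ i≤j)
    where
    go : ∀ {i j} → i ≤′ j → j < k → slot i ≡ slot j →
         (direction (slot i) ≡ 1 → P i ≤ P j) × (direction (slot i) ≡ 0 → P j ≤ P i)
    go (≤′-reflexive refl) _ _ = (λ _ → ≤-refl) , (λ _ → ≤-refl)
    go {i} {suc j} (≤′-step i≤j) 1+j<k eq =
      (λ up → ≤-trans (proj₁ below up) (<⇒≤ (rising≡1⇒< (trans (sym dir) up)))) ,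
      (λ down → ≤-trans (rising≡0⇒≥ (trans (sym dir) down)) (proj₂ below down))
      where
      slots : slot i ≡ slot j
      slots = ≤-antisym (slot-mono (≤′⇒≤ i≤j)) (≤-trans (m≤m+n (slot j) _) (≤-reflexive (sym eq)))
      dir : direction (slot i) ≡ rising j
      dir = trans (cong direction eq) (direction-slot 1+j<k)
      below = go i≤j (<-trans (n<1+n j) 1+j<k) slots

  -- Slots occupy consecutive positions; `l` is the first position of slot `j` if that slot occurs,
  -- and `k` otherwise.
  threshold : ∀ j → ∃[ l ] (∀ {i} → i < k → slot i < j → i < l) × (∀ {i} → i < k → j ≤ slot i → l ≤ i)
  threshold j = let l , below , above , _ = go k in l , below , above
    where
    go : ∀ b → ∃[ l ] (∀ {i} → i < b → slot i < j → i < l) × (∀ {i} → i < b → j ≤ slot i → l ≤ i) × l ≤ b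
    go zero = 0 , (λ ()) , (λ ()) , z≤n
    go (suc b) with slot b <? j | go b
    ... | yes lt | _ = suc b , (λ i<1+b _ → i<1+b) ,
      (λ {i} _ j≤ → ≰⇒> λ i≤b → <⇒≱ lt (≤-trans j≤ (slot-mono i≤b))) , ≤-refl
    ... | no ¬lt | l , below , above , l≤b = l ,
      (λ i<1+b lt → below (≤∧≢⇒< (s≤s⁻¹ i<1+b) λ { refl → ¬lt lt }) lt) , aboveˢ , m≤n⇒m≤1+n l≤b
      where
      aboveˢ : ∀ {i} → i < suc b → j ≤ slot i → l ≤ i
      aboveˢ {i} i<1+b j≤ with i ≟ b
      ... | no i≢b   = above (≤∧≢⇒< (s≤s⁻¹ i<1+b) i≢b) j≤
      ... | yes refl = l≤b

-- The dynamic program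

-- A matching seen from the text: `g i` is the text position that receives the pattern element at
-- position `i`. The order of positions is demanded only across edges, since these are what the
-- table tests.
record Embeds (n k : ℕ) (T P : ℕ → ℕ) (g : ℕ → ℕ) : Set where
  field
    bound     : ∀ {i} → i < k → g i < n
    ascending : ∀ {i} → suc i < k → g i < g (suc i)
    monotone  : ∀ {i j} → i < k → j < k → P i < P j → T (g i) < T (g j)

module _ {n k T P g} (embeds : Embeds n k T P g) where

  increasing : ∀ {i j} → i < j → j < k → g i < g j
  increasing i<j = go (≤⇒≤′ i<j)
    where
    go : ∀ {i j} → suc i ≤′ j → j < k → g i < g j
    go (≤′-reflexive refl) 1+i<k = Embeds.ascending embeds 1+i<k
    go (≤′-step {j} i<j) 1+j<k = <-trans (go i<j (<-trans (n<1+n j) 1+j<k)) (Embeds.ascending embeds 1+j<k)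

module DP (n k : ℕ) {{n≢0 : NonZero n}} (T P : ℕ → ℕ) where

  open Digits n
  open Slots k P

  -- From a digit to a text position, and back: the digits of a descending slot
  -- are reflected, so that frontiers advance by increasing their digit.
  pos : ℕ → ℕ → ℕ
  pos u d = u * d + (1 ∸ u) * (n ∸ 1 ∸ d)

  position : ℕ → ℕ → ℕ
  position i x = pos (direction (slot i)) (digit (slot i) x)

  digits : ℕ
  digits = suc (slot k)

  -- Every table entry above n stands for infinity, since text values are at most n.
  infinite : ℕ
  infinite = n + 1

  -- Case-free minimum of `w` and the entry `p` one step back; at digit 0, where no such entry
  -- exists, `infinite` stands in for `p`.
  advanced : ℕ → ℕ → ℕ → ℕ
  advanced d w p = w ∸ (w ∸ ((1 ∸ (1 ∸ d)) * p + (1 ∸ d) * infinite))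

  -- The text value at `y`, with a penalty of at least `infinite` if it does not exceed `a` or if
  -- `y` lies beyond `z`, the frontier of the slot of the next edge.
  placed : ℕ → ℕ → ℕ → ℕ
  placed a y z = T y + ((1 ∸ (T y ∸ a)) + (y ∸ z)) * infinite

  -- The table W′ obtained from W by placing the pattern element at position i:
  -- A minimises over the positions passed by the frontier of the slot of i.
  record Placement (i : ℕ) (W A W′ : ℕ → ℕ) : Set where
    field
      advance : ∀ {x} → x < n ^ digits →
                A x ≡ advanced (digit (slot i) x) (W x) (A (x ∸ n ^ slot i))
      place   : ∀ {x} → x < n ^ digits →
                W′ x ≡ placed (A x) (position i x) (position (suc i) x)

  slot<digits : ∀ {i} → i ≤ k → slot i < digits
  slot<digits i≤k = s≤s (slot-mono i≤k)

  pos-up : ∀ {u d} → u ≡ 1 → pos u d ≡ d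
  pos-up {d = d} refl = trans (+-identityʳ (1 * d)) (*-identityˡ d)

  pos-down : ∀ {u d} → u ≡ 0 → pos u d ≡ n ∸ 1 ∸ d
  pos-down refl = +-identityʳ _

  pos-up-mono : ∀ {u d e} → u ≡ 1 → d ≤ e → pos u d ≤ pos u e
  pos-up-mono u≡1 d≤e = subst₂ _≤_ (sym (pos-up u≡1)) (sym (pos-up u≡1)) d≤e

  pos-down-anti : ∀ {u d e} → u ≡ 0 → d ≤ e → pos u e ≤ pos u d
  pos-down-anti u≡0 d≤e =
    subst₂ _≤_ (sym (pos-down u≡0)) (sym (pos-down u≡0)) (∸-monoʳ-≤ (n ∸ 1) d≤e)

  pred<n : n ∸ 1 < n
  pred<n = subst (_≤ n) (sym (m+[n∸m]≡n (>-nonZero⁻¹ n))) ≤-refl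

  pos<n : ∀ {u d} → IsBit u → d < n → pos u d < n
  pos<n {d = d} (inj₁ u≡0) d<n =
    subst (_< n) (sym (pos-down u≡0)) (≤-<-trans (m∸n≤m (n ∸ 1) d) pred<n)
  pos<n (inj₂ u≡1) d<n = subst (_< n) (sym (pos-up u≡1)) d<n

  pos-involutive : ∀ {u d} → IsBit u → d < n → pos u (pos u d) ≡ d
  pos-involutive (inj₁ u≡0) d<n = trans (pos-down u≡0)
    (trans (cong (n ∸ 1 ∸_) (pos-down u≡0)) (m∸[m∸n]≡n (∸-monoˡ-≤ 1 d<n)))
  pos-involutive (inj₂ u≡1) d<n = trans (pos-up u≡1) (pos-up u≡1)

  position<n : ∀ i x → position i x < n
  position<n i x = pos<n (direction-isBit (slot i)) (digit<n (slot i) x)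

  advanced-≤ : ∀ d w p → advanced d w p ≤ w
  advanced-≤ d w p = ∸-min-≤ˡ w ((1 ∸ (1 ∸ d)) * p + (1 ∸ d) * infinite)

  advanced-prev : ∀ d p → (1 ∸ (1 ∸ suc d)) * p + (1 ∸ suc d) * infinite ≡ p
  advanced-prev d p rewrite 0∸n≡0 d = trans (+-identityʳ (1 * p)) (*-identityˡ p)

  advanced-≤-prev : ∀ d w p → advanced (suc d) w p ≤ p
  advanced-≤-prev d w p = ≤-trans (∸-min-≤ʳ w _) (≤-reflexive (advanced-prev d p))

  advanced-finite : ∀ d {w p} → advanced d w p ≤ n →
    advanced d w p ≡ w ⊎ ∃[ e ] d ≡ suc e × advanced d w p ≡ p
  advanced-finite zero {w} {p} ≤n with ∸-min w (1 * infinite)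
  ... | inj₁ (_ , eq) = inj₁ eq
  ... | inj₂ (_ , eq) = contradiction
    (subst (_≤ n) (trans eq (*-identityˡ infinite)) ≤n) (<⇒≱ (≤-reflexive (+-comm 1 n)))
  advanced-finite (suc d) {w} {p} _
    with ∸-min w ((1 ∸ (1 ∸ suc d)) * p + (1 ∸ suc d) * infinite)
  ... | inj₁ (_ , eq) = inj₁ eq
  ... | inj₂ (_ , eq) = inj₂ (d , refl , trans eq (advanced-prev d p))

  placed-finite : ∀ {a y z} → placed a y z ≤ n → a < T y × y ≤ z × placed a y z ≡ T y
  placed-finite {a} {y} {z} ≤n with (1 ∸ (T y ∸ a)) + (y ∸ z) in eq
  ... | suc f = contradiction
    (≤-trans (m≤m+n infinite (f * infinite)) (≤-trans (m≤n+m _ (T y)) ≤n)) (<⇒≱ (≤-reflexive (+-comm 1 n)))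
  ... | zero = m∸n≢0⇒n<m (λ T∸a≡0 → 0≢1 (m+n≡0⇒m≡0 _ eq) (cong (1 ∸_) T∸a≡0))
             , m∸n≡0⇒m≤n (m+n≡0⇒n≡0 (1 ∸ (T y ∸ a)) eq)
             , +-identityʳ (T y)

  placed-≡ : ∀ {a y z} → a < T y → y ≤ z → placed a y z ≡ T y
  placed-≡ {a} {y} {z} a<T y≤z = trans
    (cong (λ f → T y + f * infinite) (cong₂ _+_ (m≤n⇒m∸n≡0 (m<n⇒0<n∸m a<T)) (m≤n⇒m∸n≡0 y≤z)))
    (+-identityʳ (T y))

  module Place {i₀ W A W′} (i₀<k : i₀ < k) (placement : Placement i₀ W A W′) where
    open Placement placement

    c : ℕ
    c = slot i₀

    -- A finite entry of A stems from an entry of W none of whose frontiers is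
    -- further advanced.
    origin : ∀ d {x} → digit c x ≡ d → x < n ^ digits → A x ≤ n →
      ∃[ y ] y < n ^ digits × A x ≡ W y × (∀ j → digit j y ≤ digit j x)
    origin d {x} eq x<N Ax≤n with advanced-finite (digit c x) (subst (_≤ n) (advance x<N) Ax≤n)
    ... | inj₁ here = x , x<N , trans (advance x<N) here , λ j → ≤-refl
    origin zero    eq x<N Ax≤n | inj₂ (e , eq′ , _) = contradiction (trans (sym eq) eq′) λ ()
    origin (suc d) {x} eq x<N Ax≤n | inj₂ (_ , _ , there) with decrement c {x} eq
    ... | y , x≡y+s , digit-c , other =
      let z , z<N , Ay≡Wz , below = origin d digit-c y<N (subst (_≤ n) Ax≡Ay Ax≤n)
      in  z , z<N , trans Ax≡Ay Ay≡Wz , λ j → ≤-trans (below j) (digits-≤ j)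
      where
      y<N : y < n ^ digits
      y<N = ≤-<-trans (≤-trans (m≤m+n y (n ^ c)) (≤-reflexive (sym x≡y+s))) x<N
      Ax≡Ay : A x ≡ A y
      Ax≡Ay = trans (advance x<N) (trans there
        (cong A (trans (cong (_∸ n ^ c) x≡y+s) (m+n∸n≡m y (n ^ c)))))
      digits-≤ : ∀ j → digit j y ≤ digit j x
      digits-≤ j with j ≟ c
      ... | yes refl = ≤-trans (≤-reflexive digit-c) (≤-trans (n≤1+n d) (≤-reflexive (sym eq)))
      ... | no j≢c   = ≤-reflexive (other j≢c)

    -- Counterpart of `origin`: each entry of `A` takes its predecessor along coordinate `c` into
    -- account, so advancing the frontier never raises `A`.
    climb : ∀ δ {y w} → y < n ^ digits → A y ≤ w → digit c y + δ < n →
      ∃[ x ] x < n ^ digits × A x ≤ w × digit c x ≡ digit c y + δ ×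
             (∀ {j} → j ≢ c → digit j x ≡ digit j y)
    climb zero {y} y<N Ay≤w _ = y , y<N , Ay≤w , sym (+-identityʳ _) , λ _ → refl
    climb (suc δ) {y} {w} y<N Ay≤w room
      with increment c {digits} {y} (slot<digits (<⇒≤ i₀<k)) y<N
             (≤-<-trans (≤-trans (m≤m+n (suc (digit c y)) δ) (≤-reflexive (sym (+-suc (digit c y) δ)))) room)
    ... | z<N , digit-c , other =
      let x , x<N , Ax≤w , digit-x , other-x = climb δ z<N Az≤w
            (subst (_< n) (trans (+-suc (digit c y) δ) (cong (_+ δ) (sym digit-c))) room)
      in  x , x<N , Ax≤w
        , trans digit-x (trans (cong (_+ δ) digit-c) (sym (+-suc (digit c y) δ)))
        , λ j≢c → trans (other-x j≢c) (other j≢c)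
      where
      z = y + n ^ c
      Az≤w : A z ≤ w
      Az≤w = ≤-trans (≤-reflexive (trans (advance z<N)
          (cong₂ (λ d u → advanced d (W z) (A u)) digit-c (m+n∸n≡m y (n ^ c)))))
        (≤-trans (advanced-≤-prev (digit c y) (W z) (A y)) Ay≤w)

  -- g embeds the pattern elements of value at most v, with largest text value
  -- at most w; the digits of x bound the end of each edge embedded halfway.
  record Partial (v x w : ℕ) (g : ℕ → ℕ) : Set where
    field
      bound     : ∀ {i} → i < k → P i ≤ v → g i < n
      largest   : ∀ {i} → i < k → P i ≤ v → T (g i) ≤ w
      monotone  : ∀ {i j} → i < k → j < k → P i < P j → P j ≤ v → T (g i) < T (g j)
      ascending : ∀ {i} → suc i < k → P i ≤ v → P (suc i) ≤ v → g i < g (suc i)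
      pending-↗ : ∀ {i} → suc i < k → P i ≤ v → v < P (suc i) → g i ≤ position (suc i) x
      pending-↘ : ∀ {i} → suc i < k → P (suc i) ≤ v → v < P i → position (suc i) x ≤ g (suc i)

  Sound : ℕ → (ℕ → ℕ) → Set
  Sound v W = ∀ {x} → x < n ^ digits → W x ≤ n → ∃[ g ] Partial v x (W x) g

  module _ (injective : ∀ {i j} → i < k → j < k → P i ≡ P j → i ≡ j) where

    -- The embedding comes from the entry found by `origin`, extended by `y` at `i₀`. The frontiers
    -- of that entry are no further advanced than those of `x`, and pending bounds only loosen as
    -- frontiers advance, so they hold for `x` as well.
    sound-step : ∀ {i₀ v W A W′} → i₀ < k → P i₀ ≡ suc v → Placement i₀ W A W′ →
                 Sound v W → Sound (suc v) W′
    sound-step {i₀} {v} {W} {A} {W′} i₀<k Pi₀≡1+v placement sound {x} x<N W′x≤n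
      with placed-finite (subst (_≤ n) (Placement.place placement x<N) W′x≤n)
    ... | Ax<T , y≤next , placed≡T
      with Place.origin i₀<k placement (digit (slot i₀) x) refl x<N (≤-trans (<⇒≤ Ax<T) T≤n)
      where
      T≤n : T (position i₀ x) ≤ n
      T≤n = subst (_≤ n) (trans (Placement.place placement x<N) placed≡T) W′x≤n
    ...   | x′ , x′<N , Ax≡Wx′ , below
      with sound x′<N (subst (_≤ n) Ax≡Wx′ (≤-trans (<⇒≤ Ax<T) (subst (_≤ n) (trans (Placement.place placement x<N) placed≡T) W′x≤n)))
    ...     | g , partial = g [ i₀ ≔ y ] , record
      { bound     = bound′
      ; largest   = largest′
      ; monotone  = monotone′
      ; ascending = ascending′
      ; pending-↗ = pending-↗′
      ; pending-↘ = pending-↘′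
      }
      where
      open Partial partial
      y = position i₀ x

      W′x≡T : W′ x ≡ T y
      W′x≡T = trans (Placement.place placement x<N) placed≡T

      old : ∀ {i} → i < k → i ≢ i₀ → P i ≤ suc v → P i ≤ v
      old i<k i≢i₀ Pi≤1+v = s≤s⁻¹ (≤∧≢⇒< Pi≤1+v λ Pi≡1+v →
        i≢i₀ (injective i<k i₀<k (trans Pi≡1+v (sym Pi₀≡1+v))))

      old⇒≢ : ∀ {i} → P i ≤ v → i ≢ i₀
      old⇒≢ Pi≤v refl = <⇒≱ (≤-reflexive (sym Pi₀≡1+v)) Pi≤v

      at-i₀ : (g [ i₀ ≔ y ]) i₀ ≡ y
      at-i₀ = ≔-same g i₀ y

      at-other : ∀ {i} → i ≢ i₀ → (g [ i₀ ≔ y ]) i ≡ g i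
      at-other = ≔-other g y

      smaller : ∀ {i} → i < k → P i ≤ v → T (g i) < T y
      smaller i<k Pi≤v = ≤-<-trans (largest i<k Pi≤v) (subst (_< T y) Ax≡Wx′ Ax<T)

      bound′ : ∀ {i} → i < k → P i ≤ suc v → (g [ i₀ ≔ y ]) i < n
      bound′ {i} i<k Pi≤ with i ≟ i₀
      ... | yes refl = subst (_< n) (sym at-i₀) (position<n i₀ x)
      ... | no i≢i₀  = subst (_< n) (sym (at-other i≢i₀)) (bound i<k (old i<k i≢i₀ Pi≤))

      largest′ : ∀ {i} → i < k → P i ≤ suc v → T ((g [ i₀ ≔ y ]) i) ≤ W′ x
      largest′ {i} i<k Pi≤ with i ≟ i₀
      ... | yes refl = ≤-reflexive (trans (cong T at-i₀) (sym W′x≡T))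
      ... | no i≢i₀  = subst₂ _≤_ (cong T (sym (at-other i≢i₀))) (sym W′x≡T)
                         (<⇒≤ (smaller i<k (old i<k i≢i₀ Pi≤)))

      monotone′ : ∀ {i j} → i < k → j < k → P i < P j → P j ≤ suc v →
                  T ((g [ i₀ ≔ y ]) i) < T ((g [ i₀ ≔ y ]) j)
      monotone′ {i} {j} i<k j<k Pi<Pj Pj≤ with j ≟ i₀
      ... | yes refl =
        let Pi≤v = s≤s⁻¹ (≤-trans Pi<Pj Pj≤)
        in  subst₂ (λ a b → T a < T b) (sym (at-other (old⇒≢ Pi≤v))) (sym at-i₀) (smaller i<k Pi≤v)
      ... | no j≢i₀ =
        let Pj≤v = old j<k j≢i₀ Pj≤
        in  subst₂ (λ a b → T a < T b)
              (sym (at-other (old⇒≢ (≤-trans (<⇒≤ Pi<Pj) Pj≤v)))) (sym (at-other j≢i₀))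
              (monotone i<k j<k Pi<Pj Pj≤v)

      position-↗ : ∀ {i} → suc i < k → P i < P (suc i) → position (suc i) x′ ≤ position (suc i) x
      position-↗ {i} 1+i<k lt =
        pos-up-mono (trans (direction-slot 1+i<k) (rising-< lt)) (below (slot (suc i)))

      position-↘ : ∀ {i} → suc i < k → P (suc i) ≤ P i → position (suc i) x ≤ position (suc i) x′
      position-↘ {i} 1+i<k ge =
        pos-down-anti (trans (direction-slot 1+i<k) (rising-≥ ge)) (below (slot (suc i)))

      v<Pi₀ : v < P i₀
      v<Pi₀ = ≤-reflexive (sym Pi₀≡1+v)

      ascending′ : ∀ {i} → suc i < k → P i ≤ suc v → P (suc i) ≤ suc v →
                   (g [ i₀ ≔ y ]) i < (g [ i₀ ≔ y ]) (suc i)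
      ascending′ {i} 1+i<k Pi≤ P1+i≤ with i ≟ i₀ | suc i ≟ i₀
      ... | yes refl | yes 1+i≡i = contradiction 1+i≡i (1+n≢n)
      -- The edge to the right of `i₀` descends to an element placed earlier: the test just passed
      -- and `pending-↘` meet at the frontier of the slot of that edge.
      ... | yes refl | no 1+i≢i₀ =
        let P1+i≤v = old 1+i<k 1+i≢i₀ P1+i≤
        in  subst₂ _<_ (sym at-i₀) (sym (at-other 1+i≢i₀))
              (≤∧≢⇒< (≤-trans y≤next (≤-trans (position-↘ 1+i<k (≤-trans P1+i≤v (<⇒≤ v<Pi₀)))
                                              (pending-↘ 1+i<k P1+i≤v v<Pi₀)))
                λ y≡g → <-irrefl (cong T (sym y≡g)) (smaller 1+i<k P1+i≤v))
      -- The edge to the left of `i₀` ascends, and `y` is itself the frontier of its slot, to which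
      -- `pending-↗` compares `g i`.
      ... | no i≢i₀ | yes refl =
        let i<k   = <-trans (n<1+n i) 1+i<k
            Pi≤v  = old i<k i≢i₀ Pi≤
        in  subst₂ _<_ (sym (at-other i≢i₀)) (sym at-i₀)
              (≤∧≢⇒< (≤-trans (pending-↗ 1+i<k Pi≤v v<Pi₀) (position-↗ 1+i<k (≤-<-trans Pi≤v v<Pi₀)))
                λ g≡y → <-irrefl (cong T g≡y) (smaller i<k Pi≤v))
      ... | no i≢i₀ | no 1+i≢i₀ =
        subst₂ _<_ (sym (at-other i≢i₀)) (sym (at-other 1+i≢i₀))
          (ascending 1+i<k (old (<-trans (n<1+n i) 1+i<k) i≢i₀ Pi≤) (old 1+i<k 1+i≢i₀ P1+i≤))

      pending-↗′ : ∀ {i} → suc i < k → P i ≤ suc v → suc v < P (suc i) →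
                   (g [ i₀ ≔ y ]) i ≤ position (suc i) x
      pending-↗′ {i} 1+i<k Pi≤ <P1+i with i ≟ i₀
      -- The test of the new element against the slot of its right edge is exactly the new pending
      -- bound.
      ... | yes refl = subst (_≤ position (suc i) x) (sym at-i₀) y≤next
      ... | no i≢i₀  = subst (_≤ position (suc i) x) (sym (at-other i≢i₀))
        (≤-trans (pending-↗ 1+i<k (old (<-trans (n<1+n i) 1+i<k) i≢i₀ Pi≤) (<-trans (n<1+n v) <P1+i))
                 (position-↗ 1+i<k (≤-<-trans Pi≤ <P1+i)))

      pending-↘′ : ∀ {i} → suc i < k → P (suc i) ≤ suc v → suc v < P i →
                   position (suc i) x ≤ (g [ i₀ ≔ y ]) (suc i)
      pending-↘′ {i} 1+i<k P1+i≤ <Pi with suc i ≟ i₀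
      -- The new element was put on the frontier of the slot of its left edge.
      ... | yes refl = ≤-reflexive (sym at-i₀)
      ... | no 1+i≢i₀ = subst (position (suc i) x ≤_) (sym (at-other 1+i≢i₀))
        (≤-trans (position-↘ 1+i<k (≤-trans P1+i≤ (<⇒≤ <Pi)))
                 (pending-↘ 1+i<k (old 1+i<k 1+i≢i₀ P1+i≤) (<-trans (n<1+n v) <Pi)))

  sound-init : ∀ {W} → (∀ {i} → i < k → 0 < P i) → Sound 0 W
  sound-init positive _ _ = (λ _ → 0) , record
    { bound     = λ i<k Pi≤0 → contradiction Pi≤0 (<⇒≱ (positive i<k))
    ; largest   = λ i<k Pi≤0 → contradiction Pi≤0 (<⇒≱ (positive i<k))
    ; monotone  = λ _ j<k _ Pj≤0 → contradiction Pj≤0 (<⇒≱ (positive j<k))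
    ; ascending = λ 1+i<k _ P≤0 → contradiction P≤0 (<⇒≱ (positive 1+i<k))
    ; pending-↗ = λ 1+i<k Pi≤0 _ → contradiction Pi≤0 (<⇒≱ (positive (<-trans (n<1+n _) 1+i<k)))
    ; pending-↘ = λ 1+i<k P≤0 _ → contradiction P≤0 (<⇒≱ (positive 1+i<k))
    }

  sound-end : ∀ {W x} → (∀ {i} → i < k → P i ≤ k) → Sound k W → x < n ^ digits → W x ≤ n →
              ∃[ g ] Embeds n k T P g
  sound-end P≤k sound x<N Wx≤n with sound x<N Wx≤n
  ... | g , partial = g , record
    { bound     = λ i<k → Partial.bound partial i<k (P≤k i<k)
    ; ascending = λ 1+i<k → Partial.ascending partial 1+i<k (P≤k (<-trans (n<1+n _) 1+i<k)) (P≤k 1+i<k)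
    ; monotone  = λ i<k j<k lt → Partial.monotone partial i<k j<k lt (P≤k j<k)
    }

  -- Completeness of the table

  module Completeness (g : ℕ → ℕ) (embeds : Embeds n k T P g)
                      (T-positive : ∀ {y} → y < n → 0 < T y) (T≤n : ∀ {y} → y < n → T y ≤ n) where
    open Embeds embeds

    increasing-≤ : ∀ {i j} → i ≤ j → j < k → g i ≤ g j
    increasing-≤ {i} {j} i≤j j<k with i ≟ j
    ... | yes refl = ≤-refl
    ... | no i≢j   = <⇒≤ (increasing embeds (≤∧≢⇒< i≤j i≢j) j<k)

    -- On positions `pos` is an involution, so the same formula yields the digit at which the
    -- frontier sits at `g i`.
    target : ℕ → ℕ
    target i = pos (direction (slot i)) (g i)

    target<n : ∀ {i} → i < k → target i < n
    target<n {i} i<k = pos<n (direction-isBit (slot i)) (bound i<k)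

    -- W has an entry consistent with g: each slot can still reach the targets
    -- of its remaining elements, and the frontier of a slot lies beyond the
    -- remaining elements of the preceding slot that share an edge with it.
    record Consistent (v : ℕ) (W : ℕ → ℕ) (x : ℕ) : Set where
      field
        in-range  : x < n ^ digits
        finite    : W x ≤ n
        below     : ∀ {i} → i < k → v < P i → W x < T (g i)
        reachable : ∀ {i} → i < k → v < P i → digit (slot i) x ≤ target i
        bounded   : ∀ {i} → suc i < k → v < P i → slot i < slot (suc i) → g i ≤ position (suc i) x

    Complete : ℕ → (ℕ → ℕ) → Set
    Complete v W = ∃[ x ] Consistent v W x

    -- The frontier of the slot of `i₀` moves up to its target, which `reachable` has kept ahead of
    -- it, and by `climb` this does not raise `A`. There both tests of `placed` succeed, so the new
    -- entry is `T (g i₀)`.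
    complete-step : ∀ {i₀ v W A W′} → i₀ < k → P i₀ ≡ suc v → Placement i₀ W A W′ →
                    Complete v W → Complete (suc v) W′
    complete-step {i₀} {v} {W} {A} {W′} i₀<k Pi₀≡1+v placement (y , consistent)
      with Place.climb i₀<k placement (target i₀ ∸ digit (slot i₀) y) {y} {W y}
             in-range Ay≤Wy (subst (_< n) (sym reach) (target<n i₀<k))
      where
      open Consistent consistent
      Ay≤Wy : A y ≤ W y
      Ay≤Wy = subst (_≤ W y) (sym (Placement.advance placement in-range)) (advanced-≤ (digit (slot i₀) y) (W y) _)
      reach : digit (slot i₀) y + (target i₀ ∸ digit (slot i₀) y) ≡ target i₀
      reach = m+[n∸m]≡n (reachable i₀<k (≤-reflexive (sym Pi₀≡1+v)))
    ... | x , x<N , Ax≤Wy , digit-x , other = x , record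
      { in-range  = x<N
      ; finite    = subst (_≤ n) (sym W′x≡T) (T≤n (bound i₀<k))
      ; below     = λ i<k lt → subst (_< T (g _)) (sym W′x≡T)
                      (monotone i₀<k i<k (subst (_< P _) (sym Pi₀≡1+v) lt))
      ; reachable = reachable′
      ; bounded   = bounded′
      }
      where
      open Consistent consistent
      c = slot i₀

      v<Pi₀ : v < P i₀
      v<Pi₀ = ≤-reflexive (sym Pi₀≡1+v)

      digit-target : digit c x ≡ target i₀
      digit-target = trans digit-x (m+[n∸m]≡n (reachable i₀<k v<Pi₀))

      position-i₀ : ∀ {i} → slot i ≡ c → position i x ≡ g i₀
      position-i₀ {i} eq = trans (cong (λ j → pos (direction j) (digit j x)) eq)
        (trans (cong (pos (direction c)) digit-target)
               (pos-involutive (direction-isBit c) (bound i₀<k)))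

      position-other : ∀ {i} → slot i ≢ c → position i x ≡ position i y
      position-other {i} ≢c = cong (pos (direction (slot i))) (other ≢c)

      next : g i₀ ≤ position (suc i₀) x
      next with slot (suc i₀) ≟ c
      -- Without a change of slot the test compares `g i₀` with itself.
      ... | yes eq = ≤-reflexive (sym (position-i₀ {suc i₀} eq))
      ... | no ≢c with suc i₀ <? k
      ...   | yes 1+i₀<k = subst (g i₀ ≤_) (sym (position-other {suc i₀} ≢c))
                (bounded 1+i₀<k v<Pi₀ (≤∧≢⇒< (slot-mono (n≤1+n i₀)) (λ eq → ≢c (sym eq))))
      ...   | no ¬1+i₀<k = contradiction (slot-last (≮⇒≥ ¬1+i₀<k)) ≢c

      W′x≡T : W′ x ≡ T (g i₀)
      W′x≡T = trans (Placement.place placement x<N)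
        (trans (cong (λ p → placed (A x) p (position (suc i₀) x)) (position-i₀ {i₀} refl))
          (placed-≡ (≤-<-trans Ax≤Wy (below i₀<k v<Pi₀)) next))

      -- Within a slot larger values lie further along its direction, and the reflection of
      -- descending slots turns this into larger digits.
      later : ∀ {i} → i < k → suc v < P i → slot i ≡ c → target i₀ ≤ target i
      later {i} i<k lt eq with direction-isBit c | <-cmp i i₀
      ... | _ | tri≈ _ refl _ = ≤-refl
      ... | inj₂ up | tri< i<i₀ _ _ = contradiction
        (proj₁ (same-slot (<⇒≤ i<i₀) i₀<k eq) (trans (cong direction eq) up))
        (<⇒≱ (subst (_< P i) (sym Pi₀≡1+v) lt))
      ... | inj₂ up | tri> _ _ i₀<i = subst₂ _≤_ (sym (pos-up up))
        (sym (pos-up (trans (cong direction eq) up))) (<⇒≤ (increasing embeds i₀<i i<k))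
      ... | inj₁ down | tri> _ _ i₀<i = contradiction
        (proj₂ (same-slot (<⇒≤ i₀<i) i<k (sym eq)) down)
        (<⇒≱ (subst (_< P i) (sym Pi₀≡1+v) lt))
      ... | inj₁ down | tri< i<i₀ _ _ = subst₂ _≤_ (sym (pos-down down))
        (sym (pos-down (trans (cong direction eq) down)))
        (∸-monoʳ-≤ (n ∸ 1) (<⇒≤ (increasing embeds i<i₀ i₀<k)))

      reachable′ : ∀ {i} → i < k → suc v < P i → digit (slot i) x ≤ target i
      reachable′ {i} i<k lt with slot i ≟ c
      ... | yes eq = ≤-trans (≤-reflexive (trans (cong (λ j → digit j x) eq) digit-target)) (later i<k lt eq)
      ... | no ≢c  = subst (_≤ target i) (sym (other ≢c)) (reachable i<k (<-trans (n<1+n v) lt))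

      bounded′ : ∀ {i} → suc i < k → suc v < P i → slot i < slot (suc i) → g i ≤ position (suc i) x
      bounded′ {i} 1+i<k lt slot< with slot (suc i) ≟ c
      -- The frontier now sits at `g i₀`, and `i` precedes `i₀` because its slot does.
      ... | yes eq = subst (g i ≤_) (sym (position-i₀ {suc i} eq))
        (<⇒≤ (increasing embeds (≰⇒> λ i₀≤i → <⇒≱ slot< (≤-trans (≤-reflexive eq) (slot-mono i₀≤i))) i₀<k))
      ... | no ≢c = subst (g i ≤_) (sym (position-other {suc i} ≢c))
        (bounded 1+i<k (<-trans (n<1+n v) lt) slot<)

    -- An ascending slot starts at its first element, a descending one at the
    -- end of the text.
    start : ℕ → ℕ
    start j = direction j * g (proj₁ (threshold j))

    start<n : 0 < k → ∀ {j} → j < digits → start j < n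
    start<n 0<k {j} (s≤s j≤) with direction-isBit j
    ... | inj₁ down = subst (λ u → u * g (proj₁ (threshold j)) < n) (sym down) (>-nonZero⁻¹ n)
    ... | inj₂ up = subst (λ u → u * g (proj₁ (threshold j)) < n) (sym up)
      (subst (_< n) (sym (*-identityˡ _)) (bound (≤-<-trans
        -- The last position already has slot number `slot k`, which is at least `j`, so the
        -- threshold of `j` lies below `k`.
        (proj₂ (proj₂ (threshold j)) pred-k<k
          (≤-trans j≤ (≤-reflexive (trans (cong slot (sym 1+pred)) (slot-last (≤-reflexive (sym 1+pred)))))))
        pred-k<k)))
      where
      1+pred : suc (k ∸ 1) ≡ k
      1+pred = m+[n∸m]≡n 0<k
      pred-k<k : k ∸ 1 < k
      pred-k<k = ≤-reflexive 1+pred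

    -- An ascending slot starts at its leftmost element and a descending one at digit 0, so no
    -- target is behind its frontier. For `bounded`, earlier slots lie to the left of the former,
    -- and nothing lies to the right of the end of the text.
    complete-init : ∀ {W} → 0 < k → (∀ {x} → x < n ^ digits → W x ≡ 0) → Complete 0 W
    complete-init {W} 0<k W≡0 with fromDigits digits start (start<n 0<k)
    ... | x , x<N , digits-x = x , record
      { in-range  = x<N
      ; finite    = subst (_≤ n) (sym (W≡0 x<N)) z≤n
      ; below     = λ i<k _ → subst (_< T (g _)) (sym (W≡0 x<N)) (T-positive (bound i<k))
      ; reachable = λ i<k _ → reachable₀ i<k
      ; bounded   = λ 1+i<k _ → bounded₀ 1+i<k
      }
      where
      reachable₀ : ∀ {i} → i < k → digit (slot i) x ≤ target i
      reachable₀ {i} i<k = subst (_≤ target i) (sym (digits-x (slot<digits (<⇒≤ i<k))))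
        (go (direction-isBit (slot i)))
        where
        l = proj₁ (threshold (slot i))
        go : IsBit (direction (slot i)) → start (slot i) ≤ target i
        go (inj₁ down) = subst (λ u → u * g l ≤ target i) (sym down) z≤n
        go (inj₂ up) = subst₂ _≤_ (trans (sym (*-identityˡ (g l))) (cong (_* g l) (sym up))) (sym (pos-up up))
          (increasing-≤ (proj₂ (proj₂ (threshold (slot i))) i<k ≤-refl) i<k)

      bounded₀ : ∀ {i} → suc i < k → slot i < slot (suc i) → g i ≤ position (suc i) x
      bounded₀ {i} 1+i<k slot< = subst (λ d → g i ≤ pos (direction j) d)
        (sym (digits-x (slot<digits (<⇒≤ 1+i<k)))) (go (direction-isBit j))
        where
        j = slot (suc i)
        l = proj₁ (threshold j)
        i<k = <-trans (n<1+n i) 1+i<k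
        go : IsBit (direction j) → g i ≤ pos (direction j) (start j)
        go (inj₁ down) = subst (g i ≤_) (sym (trans (pos-down down)
          (cong (λ u → n ∸ 1 ∸ u * g l) down))) (∸-monoˡ-≤ 1 (bound i<k))
        go (inj₂ up) = subst (g i ≤_) (sym (trans (pos-up up)
          (trans (cong (_* g l) up) (*-identityˡ (g l)))))
          (increasing-≤ (<⇒≤ (proj₁ (proj₂ (threshold j)) i<k slot<))
            (≤-<-trans (proj₂ (proj₂ (threshold j)) 1+i<k ≤-refl) 1+i<k))

    complete-end : ∀ {v W} → Complete v W → ∃[ x ] x < n ^ digits × W x ≤ n
    complete-end (x , consistent) = x , Consistent.in-range consistent , Consistent.finite consistent

-- The machine program

$n $k $1 $2 $∞ $last $base $0 $i $todo $s $d : ℕ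
$n    = 0
$k    = 1
$1    = 2
$2    = 3
$∞    = 4
$last = 5
$base = 6
$0    = 7
$i    = 8
$todo = 9
$s    = 10
$d    = 11

$N $W $A $q $best $sa $sb $ua $ub $ūa $ūb $x $left $da $db : ℕ
$N    = 12
$W    = 13
$A    = 14
$q    = 15
$best = 16
$sa   = 17
$sb   = 18
$ua   = 19
$ub   = 20
$ūa   = 21
$ūb   = 22
$x    = 23
$left = 24
$da   = 25
$db   = 26

$t $u $v $w $y : ℕ
$t = 27
$u = 28
$v = 29
$w = 30
$y = 31

-- Register `$0` holds zero and serves for copying, as subtracting it leaves a value unchanged. `$s`
-- and `$d` carry the stride and the direction of the current slot; the last two instructions take a
-- sign, which makes `$d` equal to `rising 0`.
initialise : List Basic
initialise =
  const $1 1 ∷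
  const $2 2 ∷
  const $0 0 ∷
  arith $∞ add $n $1 ∷
  arith $last sub $n $1 ∷
  arith $base add $n $k ∷
  const $i 0 ∷
  arith $todo sub $k $i ∷
  const $s 1 ∷
  arith $t add $n $0 ∷
  load $u $t ∷
  arith $t add $n $1 ∷
  load $d $t ∷
  arith $d sub $d $u ∷
  arith $d sub $1 $d ∷
  arith $d sub $1 $d ∷ []

-- For the pattern element p at position i, stores at p + p + (p + p) + n + k
-- the strides and directions of the slots of its left and right edges.
analyseElement : List Basic
analyseElement =
  arith $t add $n $i ∷
  load $u $t ∷
  arith $t add $t $1 ∷
  load $v $t ∷
  arith $v sub $v $u ∷
  arith $v sub $1 $v ∷
  arith $v sub $1 $v ∷
  arith $v add $d $v ∷
  arith $v mod $v $2 ∷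
  arith $i add $i $1 ∷
  -- The loop counter, now `k ∸ suc i`, doubles as the cap in `change`.
  arith $todo sub $k $i ∷
  arith $w sub $v $todo ∷
  arith $v sub $v $w ∷
  -- A multiplication of the stride by `n` or by 1, according to whether the slot changes, in the
  -- form `s + s * e * (n ∸ 1)`.
  arith $w mul $s $v ∷
  arith $w mul $w $last ∷
  arith $w add $s $w ∷
  arith $y add $d $v ∷
  arith $y mod $y $2 ∷
  -- Records of four cells are indexed by value rather than by position, so that the search meets
  -- the elements in increasing order of value.
  arith $u add $u $u ∷
  arith $u add $u $u ∷
  arith $u add $u $base ∷
  store $u $s ∷
  arith $u add $u $1 ∷
  store $u $w ∷
  arith $u add $u $1 ∷
  store $u $d ∷
  arith $u add $u $1 ∷
  store $u $y ∷
  arith $s sub $w $0 ∷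
  arith $d sub $y $0 ∷ []

prepareTables : List Basic
prepareTables =
  -- Here `$s` is the stride of the last slot, so one more factor `n` gives the number of entries.
  arith $N mul $s $n ∷
  arith $W add $k $1 ∷
  arith $W add $W $W ∷
  arith $W add $W $W ∷
  arith $W add $W $base ∷
  arith $A add $W $N ∷
  const $i 0 ∷
  arith $todo sub $k $i ∷
  -- One record before the first: `beginElement` advances before it reads, and pattern values start
  -- at 1.
  arith $q sub $base $0 ∷
  const $best 0 ∷ []

beginElement : List Basic
beginElement =
  const $t 4 ∷
  arith $q add $q $t ∷
  load $sa $q ∷
  arith $t add $q $1 ∷
  load $sb $t ∷
  arith $t add $t $1 ∷
  load $ua $t ∷
  arith $t add $t $1 ∷
  load $ub $t ∷
  arith $ūa sub $1 $ua ∷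
  arith $ūb sub $1 $ub ∷
  arith $best sub $∞ $0 ∷
  const $x 0 ∷
  arith $left sub $N $x ∷
  const $da 0 ∷
  const $db 0 ∷ []

updateEntry : List Basic
updateEntry =
  arith $t add $W $x ∷
  load $u $t ∷
  arith $v sub $1 $da ∷
  arith $w sub $1 $v ∷
  -- At digit 0 this does not lead to a predecessor; whatever is loaded is then multiplied by 0.
  arith $y sub $x $sa ∷
  arith $y add $A $y ∷
  load $y $y ∷
  arith $w mul $w $y ∷
  arith $v mul $v $∞ ∷
  arith $w add $w $v ∷
  arith $w sub $u $w ∷
  arith $u sub $u $w ∷
  arith $v mul $ua $da ∷
  arith $w sub $last $da ∷
  arith $w mul $ūa $w ∷
  arith $v add $v $w ∷
  arith $w mul $ub $db ∷
  arith $y sub $last $db ∷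
  arith $y mul $ūb $y ∷
  arith $w add $w $y ∷
  arith $w sub $v $w ∷
  -- The text starts at cell 0, so a text position is its own address.
  load $v $v ∷
  arith $y sub $v $u ∷
  arith $y sub $1 $y ∷
  arith $y add $y $w ∷
  arith $y mul $y $∞ ∷
  arith $y add $v $y ∷
  arith $w add $A $x ∷
  store $w $u ∷
  store $t $y ∷
  arith $t sub $best $y ∷
  arith $best sub $best $t ∷
  arith $x add $x $1 ∷
  -- Digits are updated without division: a digit goes up, modulo `n`, exactly when its stride
  -- divides the new `x`.
  arith $t mod $x $sa ∷
  arith $t sub $1 $t ∷
  arith $t add $da $t ∷
  arith $da mod $t $n ∷
  arith $t mod $x $sb ∷
  arith $t sub $1 $t ∷
  arith $t add $db $t ∷
  arith $db mod $t $n ∷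
  arith $left sub $N $x ∷ []

endElement : List Basic
endElement =
  arith $i add $i $1 ∷
  arith $todo sub $k $i ∷ []

answer : List Basic
answer =
  arith $t sub $best $n ∷
  arith $n sub $1 $t ∷ []

program : Cmd
program =
  block initialise ⨾
  while $todo (block analyseElement) ⨾
  block prepareTables ⨾
  while $todo (block beginElement ⨾ while $left (block updateEntry) ⨾ block endElement) ⨾
  block answer

-- Addresses of the records and effects of the loop bodies

quad : ℕ → ℕ → ℕ
quad base p = p + p + (p + p) + base

record Params (m : Memory) (q sa sb ua ub : ℕ) : Set where
  field
    stride₁    : m q ≡ sa
    stride₂    : m (q + 1) ≡ sb
    direction₁ : m (q + 1 + 1) ≡ ua
    direction₂ : m (q + 1 + 1 + 1) ≡ ub

-- The constants 1 and 2 are variables here, so that all hypotheses can be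
-- eliminated by unification and the conclusions hold by computation.
analyseElement-effect : ∀ {r m n k one two last base zero i s d} →
  r $n ≡ n → r $k ≡ k → r $1 ≡ one → r $2 ≡ two → r $last ≡ last → r $base ≡ base → r $0 ≡ zero →
  r $i ≡ i → r $s ≡ s → r $d ≡ d →
  let p  = m (n + i)
      y  = ⟦ mod ⟧ (d + (one ∸ (one ∸ (m (n + i + one) ∸ p)))) two
      e  = y ∸ (y ∸ (k ∸ (i + one)))
      s′ = s + s * e * last
      d′ = ⟦ mod ⟧ (d + e) two
      q  = p + p + (p + p) + base
      r′ = regAfter analyseElement r m
  in r′ $i ≡ i + one × r′ $todo ≡ k ∸ (i + one) × r′ $s ≡ s′ ∸ zero × r′ $d ≡ d′ ∸ zero ×
     memAfter analyseElement r m ≡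
       (((m [ q ≔ s ]) [ q + one ≔ s′ ]) [ q + one + one ≔ d ]) [ q + one + one + one ≔ d′ ]
analyseElement-effect refl refl refl refl refl refl refl refl refl refl =
  refl , refl , refl , refl , refl

updateEntry-effect : ∀ {r m n one ∞ last sa sb ua ub ūa ūb da db x W A N best} →
  r $n ≡ n → r $1 ≡ one → r $∞ ≡ ∞ → r $last ≡ last →
  r $sa ≡ sa → r $sb ≡ sb → r $ua ≡ ua → r $ub ≡ ub → r $ūa ≡ ūa → r $ūb ≡ ūb →
  r $da ≡ da → r $db ≡ db → r $x ≡ x → r $W ≡ W → r $A ≡ A → r $N ≡ N → r $best ≡ best →
  let w  = m (W + x)
      a  = w ∸ (w ∸ ((one ∸ (one ∸ da)) * m (A + (x ∸ sa)) + (one ∸ da) * ∞))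
      y  = ua * da + ūa * (last ∸ da)
      z  = ub * db + ūb * (last ∸ db)
      w′ = m y + ((one ∸ (m y ∸ a)) + (y ∸ z)) * ∞
      r′ = regAfter updateEntry r m
  in r′ $best ≡ best ∸ (best ∸ w′) × r′ $x ≡ x + one × r′ $left ≡ N ∸ (x + one) ×
     r′ $da ≡ ⟦ mod ⟧ (da + (one ∸ ⟦ mod ⟧ (x + one) sa)) n ×
     r′ $db ≡ ⟦ mod ⟧ (db + (one ∸ ⟦ mod ⟧ (x + one) sb)) n ×
     memAfter updateEntry r m ≡ (m [ A + x ≔ a ]) [ W + x ≔ w′ ]
updateEntry-effect refl refl refl refl refl refl refl refl refl refl refl refl refl refl refl refl refl =
  refl , refl , refl , refl , refl , refl

-- Correctness and running time of the machine program

quad-suc : ∀ b p → quad b p + 4 ≡ quad b (suc p)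
quad-suc = lemma
  where
  lemma : ∀ b p → p + p + (p + p) + b + 4 ≡ suc p + suc p + (suc p + suc p) + b
  lemma = solve-∀

quad-mono : ∀ b {p p′} → p ≤ p′ → quad b p ≤ quad b p′
quad-mono b p≤p′ = +-monoˡ-≤ b (+-mono-≤ (+-mono-≤ p≤p′ p≤p′) (+-mono-≤ p≤p′ p≤p′))

quad-< : ∀ b {p p′} → p < p′ → quad b p + 1 + 1 + 1 < quad b p′
quad-< b {p} {p′} p<p′ = ≤-trans (≤-reflexive (trans (last (quad b p)) (quad-suc b p))) (quad-mono b p<p′)
  where
  last : ∀ q → suc (q + 1 + 1 + 1) ≡ q + 4
  last = solve-∀

n<n+1 : ∀ n → n < n + 1
n<n+1 n = ≤-reflexive (+-comm 1 n)

module _ {q : ℕ} where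

  store₄ : Memory → (a b c d : ℕ) → Memory
  store₄ m a b c d =
    (((m [ q ≔ a ]) [ q + 1 ≔ b ]) [ q + 1 + 1 ≔ c ]) [ q + 1 + 1 + 1 ≔ d ]

  private
    q₁ = n<n+1 q
    q₂ = n<n+1 (q + 1)
    q₃ = n<n+1 (q + 1 + 1)

  module _ {m : Memory} {a b c d : ℕ} where
    private
      m₁ = m [ q ≔ a ]
      m₂ = m₁ [ q + 1 ≔ b ]
      m₃ = m₂ [ q + 1 + 1 ≔ c ]

    store₄-outside : ∀ {y} → y < q ⊎ q + 1 + 1 + 1 < y → store₄ m a b c d y ≡ m y
    store₄-outside (inj₁ y<q) =
      trans (≔-other m₃ d (<⇒≢ (<-trans (<-trans (<-trans y<q q₁) q₂) q₃)))
      (trans (≔-other m₂ c (<⇒≢ (<-trans (<-trans y<q q₁) q₂)))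
      (trans (≔-other m₁ b (<⇒≢ (<-trans y<q q₁))) (≔-other m a (<⇒≢ y<q))))
    store₄-outside (inj₂ <y) =
      trans (≔-other m₃ d (>⇒≢ <y))
      (trans (≔-other m₂ c (>⇒≢ (<-trans q₃ <y)))
      (trans (≔-other m₁ b (>⇒≢ (<-trans q₂ (<-trans q₃ <y))))
        (≔-other m a (>⇒≢ (<-trans q₁ (<-trans q₂ (<-trans q₃ <y)))))))

    store₄-params : Params (store₄ m a b c d) q a b c d
    store₄-params = record
      { stride₁    = trans (≔-other m₃ d (<⇒≢ (<-trans q₁ (<-trans q₂ q₃))))
                     (trans (≔-other m₂ c (<⇒≢ (<-trans q₁ q₂)))
                     (trans (≔-other m₁ b (<⇒≢ q₁)) (≔-same m q a)))
      ; stride₂    = trans (≔-other m₃ d (<⇒≢ (<-trans q₂ q₃)))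
                     (trans (≔-other m₂ c (<⇒≢ q₂)) (≔-same m₁ (q + 1) b))
      ; direction₁ = trans (≔-other m₃ d (<⇒≢ q₃)) (≔-same m₂ (q + 1 + 1) c)
      ; direction₂ = ≔-same m₃ (q + 1 + 1 + 1) d
      }

  Params-cong : ∀ {m m′ a b c d} → (∀ {y} → q ≤ y → y ≤ q + 1 + 1 + 1 → m′ y ≡ m y) →
                Params m q a b c d → Params m′ q a b c d
  Params-cong same params = record
    { stride₁    = trans (same ≤-refl (<⇒≤ (<-trans q₁ (<-trans q₂ q₃)))) (Params.stride₁ params)
    ; stride₂    = trans (same (<⇒≤ q₁) (<⇒≤ (<-trans q₂ q₃))) (Params.stride₂ params)
    ; direction₁ = trans (same (<⇒≤ (<-trans q₁ q₂)) (<⇒≤ q₃)) (Params.direction₁ params)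
    ; direction₂ = trans (same (<⇒≤ (<-trans q₁ (<-trans q₂ q₃))) ≤-refl) (Params.direction₂ params)
    }

-- Sums the costs incurred once, per pattern element and per table entry of an element; `time-bound`
-- charges each of them to `k * entries`.
timeFactor : ℕ
timeFactor = length initialise + 1 + length prepareTables + 1 + length answer +
  (2 + length analyseElement + (2 + length beginElement + 1 + length endElement)) +
  (2 + length updateEntry)

module Search (n k : ℕ) {{n≢0 : NonZero n}} (m₀ : Memory) (0<k : 0 < k)
  (text>0 : ∀ {y} → y < n → 0 < m₀ y)
  (text≤n : ∀ {y} → y < n → m₀ y ≤ n)
  (pattern>0 : ∀ {i} → i < k → 0 < m₀ (n + i))
  (pattern≤k : ∀ {i} → i < k → m₀ (n + i) ≤ k)
  (injective : ∀ {i j} → i < k → j < k → m₀ (n + i) ≡ m₀ (n + j) → i ≡ j)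
  (surjective : ∀ {v} → v < k → ∃[ i ] i < k × m₀ (n + i) ≡ suc v)
  (rest≡0 : ∀ {a} → n + k ≤ a → m₀ a ≡ 0)
  where

  P : ℕ → ℕ
  P i = m₀ (n + i)

  open Digits n
  open Slots k P
  open DP n k m₀ P

  base tableW tableA entries : ℕ
  base    = n + k
  tableW  = quad base (k + 1)
  entries = n ^ digits
  tableA  = tableW + entries

  record Fixed (r : Memory) : Set where
    field
      n≡    : r $n ≡ n
      k≡    : r $k ≡ k
      1≡    : r $1 ≡ 1
      2≡    : r $2 ≡ 2
      ∞≡    : r $∞ ≡ n + 1
      last≡ : r $last ≡ n ∸ 1
      base≡ : r $base ≡ base
      0≡    : r $0 ≡ 0

  ParamsOf : Memory → ℕ → Set
  ParamsOf m j = Params m (quad base (P j)) (n ^ slot j) (n ^ slot (suc j))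
                        (direction (slot j)) (direction (slot (suc j)))

  -- The records lie between the two protected regions: `low` keeps the input readable, and `high`
  -- keeps the zeros that will form the initial table.
  record Analysed (i : ℕ) (r m : Memory) : Set where
    field
      fixed  : Fixed r
      i≡     : r $i ≡ i
      todo≡  : r $todo ≡ k ∸ i
      s≡     : r $s ≡ n ^ slot i
      d≡     : r $d ≡ direction (slot i)
      low    : ∀ {a} → a < quad base 1 → m a ≡ m₀ a
      high   : ∀ {a} → tableW ≤ a → m a ≡ m₀ a
      params : ∀ {j} → j < i → ParamsOf m j

  stride-suc : ∀ i → n ^ slot i + n ^ slot i * change (direction (slot i)) i * (n ∸ 1) ≡ n ^ slot (suc i)
  stride-suc i with change (direction (slot i)) i | change-isBit (direction (slot i)) i
  ... | _ | inj₁ refl = trans (cong (λ z → s + z * (n ∸ 1)) (*-zeroʳ s))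
                          (trans (+-identityʳ s) (cong (n ^_) (sym (+-identityʳ (slot i)))))
    where s = n ^ slot i
  ... | _ | inj₂ refl = trans (step₁ s (n ∸ 1)) (trans (cong (_* s) (m+[n∸m]≡n (>-nonZero⁻¹ n)))
                          (cong (n ^_) (+-comm 1 (slot i))))
    where
    s = n ^ slot i
    step₁ : ∀ s l → s + s * 1 * l ≡ (1 + l) * s
    step₁ = solve-∀

  analysed-suc : ∀ {i} → i < k → Analysed i ⊢ block analyseElement ⟨ length analyseElement ⟩ Analysed (suc i)
  analysed-suc {i} i<k = ⊢-block analyseElement λ {r} {m} inv →
    let open Analysed inv
        open Fixed fixed
    in finish {r} {m} {regAfter analyseElement r m} {memAfter analyseElement r m} inv
         (low (≤-trans (+-monoʳ-< n i<k) (m≤n+m base 4)))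
         (trans (cong m (trans (+-assoc n i 1) (cong (n +_) (+-comm i 1))))
           -- At the last position this reads the cell after the pattern, which still lies below the
           -- first record.
           (low (s≤s (≤-trans (+-monoʳ-≤ n i<k) (m≤n+m base 3)))))
         (+-comm i 1)
         (record { n≡ = n≡ ; k≡ = k≡ ; 1≡ = 1≡ ; 2≡ = 2≡ ; ∞≡ = ∞≡ ; last≡ = last≡
                 ; base≡ = base≡ ; 0≡ = 0≡ })
         (analyseElement-effect {r} {m} n≡ k≡ 1≡ 2≡ last≡ base≡ 0≡ i≡ s≡ d≡)
    where
    -- The loaded values are variables here, so that matching on `refl` replaces them everywhere at
    -- once.
    finish : ∀ {r m r′ m′ p p⁺ i⁺} → Analysed i r m → p ≡ P i → p⁺ ≡ P (suc i) → i⁺ ≡ suc i →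
      Fixed r′ →
      let y  = (direction (slot i) + (1 ∸ (1 ∸ (p⁺ ∸ p)))) % 2
          e  = y ∸ (y ∸ (k ∸ i⁺))
          s′ = n ^ slot i + n ^ slot i * e * (n ∸ 1)
          d′ = (direction (slot i) + e) % 2
          q  = p + p + (p + p) + base
      in r′ $i ≡ i⁺ × r′ $todo ≡ k ∸ i⁺ × r′ $s ≡ s′ × r′ $d ≡ d′ ×
         m′ ≡ store₄ {q} m (n ^ slot i) s′ (direction (slot i)) d′ →
         Analysed (suc i) r′ m′
    finish {m = m} inv refl refl refl fixed′ (i′≡ , todo′≡ , s′≡ , d′≡ , refl) = record
      { fixed  = fixed′
      ; i≡     = i′≡
      ; todo≡  = todo′≡
      ; s≡     = trans s′≡ (stride-suc i)
      ; d≡     = trans d′≡ (sym direction-suc)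
      ; low    = λ a< → trans (store₄-outside {q} {m} (inj₁ (<-≤-trans a< (quad-mono base (pattern>0 i<k))))) (low a<)
      ; high   = λ ≤a → trans (store₄-outside {q} {m} (inj₂ (<-≤-trans
                   (quad-< base (subst (P i <_) (+-comm 1 k) (s≤s (pattern≤k i<k)))) ≤a))) (high ≤a)
      ; params = params′
      }
      where
      open Analysed inv
      q = quad base (P i)
      direction-suc : direction (slot (suc i)) ≡ (direction (slot i) + change (direction (slot i)) i) % 2
      direction-suc = direction-+ (slot i) _
      params′ : ∀ {j} → j < suc i → ParamsOf _ j
      params′ {j} j<1+i with <-cmp (P j) (P i)
      ... | tri< lt _ _ = Params-cong
        (λ _ y≤ → store₄-outside {q} {m} (inj₁ (≤-<-trans y≤ (quad-< base lt))))
        (params (≤∧≢⇒< (s≤s⁻¹ j<1+i) λ { refl → <-irrefl refl lt }))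
      ... | tri> _ _ gt = Params-cong
        (λ q≤y _ → store₄-outside {q} {m} (inj₂ (<-≤-trans (quad-< base gt) q≤y)))
        (params (≤∧≢⇒< (s≤s⁻¹ j<1+i) λ { refl → <-irrefl refl gt }))
      ... | tri≈ _ eq _ with injective (≤-<-trans (s≤s⁻¹ j<1+i) i<k) i<k eq
      ...   | refl = subst₂ (λ b d → Params (store₄ {q} m (n ^ slot i) s′ (direction (slot i)) d′) q
                                      (n ^ slot i) b (direction (slot i)) d)
                       (stride-suc i) (sym direction-suc) store₄-params
        where
        e  = change (direction (slot i)) i
        s′ = n ^ slot i + n ^ slot i * e * (n ∸ 1)
        d′ = (direction (slot i) + e) % 2

  record Start (r m : Memory) : Set where
    field
      n≡ : r $n ≡ n
      k≡ : r $k ≡ k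
      m≡ : ∀ a → m a ≡ m₀ a

  analysed-zero : Start ⊢ block initialise ⟨ length initialise ⟩ Analysed 0
  analysed-zero = ⊢-block initialise λ {r} {m} start →
    let open Start start in record
      { fixed  = record
        { n≡ = n≡ ; k≡ = k≡ ; 1≡ = refl ; 2≡ = refl ; ∞≡ = cong (_+ 1) n≡ ; last≡ = cong (_∸ 1) n≡
        ; base≡ = cong₂ _+_ n≡ k≡ ; 0≡ = refl }
      ; i≡     = refl
      ; todo≡  = k≡
      ; s≡     = refl
      ; d≡     = trans (cong₂ (λ a b → 1 ∸ (1 ∸ (a ∸ b)))
                         (trans (m≡ (r $n + 1)) (cong (λ a → m₀ (a + 1)) n≡))
                         (trans (m≡ (r $n + 0)) (cong (λ a → m₀ (a + 0)) n≡)))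
                       (sym direction-0)
      ; low    = λ _ → m≡ _
      ; high   = λ _ → m≡ _
      ; params = λ ()
      }
    where
    direction-0 : direction 0 ≡ rising 0
    direction-0 with rising 0 | rising-isBit 0
    ... | _ | inj₁ refl = refl
    ... | _ | inj₂ refl = refl

  -- The running minimum over an element starts at `infinite`, which no entry need equal. Hence only
  -- a finite `b` promises an entry, and of that entry only finiteness is recorded, as the answer
  -- asks for no more.
  record Minimum (b N : ℕ) (f : ℕ → ℕ) : Set where
    field
      attained : b ≤ n → ∃[ x ] x < N × f x ≤ n
      minimal  : ∀ {x} → x < N → b ≤ f x

  table : Memory → ℕ → ℕ
  table m x = m (tableW + x)

  -- The contents of the table at `tableA` do not belong to the invariant, since each element
  -- rebuilds them.
  record Searched (v : ℕ) (r m : Memory) : Set where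
    field
      fixed    : Fixed r
      i≡       : r $i ≡ v
      todo≡    : r $todo ≡ k ∸ v
      q≡       : r $q ≡ quad base v
      N≡       : r $N ≡ entries
      W≡       : r $W ≡ tableW
      A≡       : r $A ≡ tableA
      minimum  : Minimum (r $best) entries (table m)
      text     : ∀ {a} → a < n → m a ≡ m₀ a
      params   : ∀ {j} → j < k → ParamsOf m j
      sound    : Sound v (table m)
      complete : ∀ g (embeds : Embeds n k m₀ P g) →
                 Completeness.Complete g embeds text>0 text≤n v (table m)

  0<entries : 0 < entries
  0<entries = >-nonZero⁻¹ entries {{m^n≢0 n digits}}

  base≤tableW : base ≤ tableW
  base≤tableW = m≤n+m base (k + 1 + (k + 1) + (k + 1 + (k + 1)))

  searched-zero : Analysed k ⊢ block prepareTables ⟨ length prepareTables ⟩ Searched 0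
  searched-zero = ⊢-block prepareTables λ {r} {m} inv →
    let open Analysed inv
        open Fixed fixed
        N≡ = trans (cong₂ _*_ s≡ n≡) (*-comm (n ^ slot k) n)
        W≡ = cong₂ quad base≡ (cong₂ _+_ k≡ 1≡)
        table≡0 : ∀ {x} → x < entries → table m x ≡ 0
        table≡0 {x} _ = trans (high (m≤m+n tableW x)) (rest≡0 (≤-trans base≤tableW (m≤m+n tableW x)))
    in record
      { fixed    = record { n≡ = n≡ ; k≡ = k≡ ; 1≡ = 1≡ ; 2≡ = 2≡ ; ∞≡ = ∞≡ ; last≡ = last≡
                          ; base≡ = base≡ ; 0≡ = 0≡ }
      ; i≡       = refl
      ; todo≡    = k≡
      ; q≡       = cong₂ _∸_ base≡ 0≡
      ; N≡       = N≡
      ; W≡       = W≡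
      ; A≡       = cong₂ _+_ W≡ N≡
      ; minimum  = record
        { attained = λ _ → 0 , 0<entries , subst (_≤ n) (sym (table≡0 0<entries)) z≤n
        ; minimal  = λ _ → z≤n }
      ; text     = λ a<n → low (≤-trans a<n (≤-trans (m≤m+n n k) (m≤n+m base 4)))
      ; params   = params
      ; sound    = sound-init {table m} pattern>0
      ; complete = λ g embeds → Completeness.complete-init g embeds text>0 text≤n 0<k table≡0
      }

  -- By `suc-/` a carry reaches digit `c` exactly when `n ^ c` divides `suc x`; the outer reduction
  -- wraps the digit around.
  digit-suc : ∀ c x → ⟦ mod ⟧ (digit c x + (1 ∸ ⟦ mod ⟧ (suc x) (n ^ c))) n ≡ digit c (suc x)
  digit-suc c x = begin
    ⟦ mod ⟧ (digit c x + (1 ∸ ⟦ mod ⟧ (suc x) s)) n  ≡⟨ ⟦mod⟧-% _ n ⟩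
    (digit c x + (1 ∸ ⟦ mod ⟧ (suc x) s)) % n        ≡⟨ cong₂ (λ d e → (d + (1 ∸ e)) % n) (digit-/ c x) (⟦mod⟧-% (suc x) s) ⟩
    (x / s % n + (1 ∸ suc x % s)) % n                ≡⟨ %-distribˡ-+ (x / s % n) _ n ⟩
    (x / s % n % n + (1 ∸ suc x % s) % n) % n        ≡⟨ cong (λ d → (d + (1 ∸ suc x % s) % n) % n) (m%n%n≡m%n (x / s) n) ⟩
    (x / s % n + (1 ∸ suc x % s) % n) % n            ≡⟨ %-distribˡ-+ (x / s) _ n ⟨
    (x / s + (1 ∸ suc x % s)) % n                    ≡⟨ cong (_% n) (suc-/ x s) ⟨
    suc x / s % n                                    ≡⟨ digit-/ c (suc x) ⟨
    digit c (suc x)                                  ∎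
    where
    open ≡-Reasoning
    s = n ^ c
    instance s≢0 = m^n≢0 n c

  -- The table is overwritten in place, so its old version is named through the memory `m₁` before
  -- the element; from `x` on, the two still agree.
  record Updated (i v : ℕ) (m₁ : Memory) (x : ℕ) (r m : Memory) : Set where
    field
      fixed   : Fixed r
      i≡      : r $i ≡ v
      q≡      : r $q ≡ quad base (suc v)
      N≡      : r $N ≡ entries
      W≡      : r $W ≡ tableW
      A≡      : r $A ≡ tableA
      sa≡     : r $sa ≡ n ^ slot i
      sb≡     : r $sb ≡ n ^ slot (suc i)
      ua≡     : r $ua ≡ direction (slot i)
      ub≡     : r $ub ≡ direction (slot (suc i))
      ūa≡     : r $ūa ≡ 1 ∸ direction (slot i)
      ūb≡     : r $ūb ≡ 1 ∸ direction (slot (suc i))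
      x≡      : r $x ≡ x
      left≡   : r $left ≡ entries ∸ x
      da≡     : r $da ≡ digit (slot i) x
      db≡     : r $db ≡ digit (slot (suc i)) x
      low     : ∀ {a} → a < tableW → m a ≡ m₁ a
      pending : ∀ {y} → x ≤ y → y < entries → table m y ≡ table m₁ y
      advance : ∀ {y} → y < x → m (tableA + y) ≡
                advanced (digit (slot i) y) (table m₁ y) (m (tableA + (y ∸ n ^ slot i)))
      place   : ∀ {y} → y < x → table m y ≡
                placed (m (tableA + y)) (position i y) (position (suc i) y)
      minimum : Minimum (r $best) x (table m)

  minimum-suc : ∀ {b x f f′ w} → Minimum b x f → (∀ {y} → y < x → f′ y ≡ f y) → f′ x ≡ w →
                Minimum (b ∸ (b ∸ w)) (suc x) f′
  minimum-suc {b} {x} {f} {f′} {w} minimum same new = record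
    { attained = attained′
    ; minimal  = minimal′
    }
    where
    open Minimum minimum
    attained′ : b ∸ (b ∸ w) ≤ n → ∃[ y ] y < suc x × f′ y ≤ n
    attained′ ≤n with ∸-min b w
    ... | inj₁ (_ , eq) = let y , y<x , fy≤n = attained (subst (_≤ n) eq ≤n) in
      y , m<n⇒m<1+n y<x , subst (_≤ n) (sym (same y<x)) fy≤n
    ... | inj₂ (_ , eq) = x , n<1+n x , subst (_≤ n) (trans eq (sym new)) ≤n
    minimal′ : ∀ {y} → y < suc x → b ∸ (b ∸ w) ≤ f′ y
    minimal′ {y} y<1+x with y ≟ x
    ... | yes refl = ≤-trans (∸-min-≤ʳ b w) (≤-reflexive (sym new))
    ... | no y≢x   = let y<x = ≤∧≢⇒< (s≤s⁻¹ y<1+x) y≢x in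
      ≤-trans (∸-min-≤ˡ b w) (≤-trans (minimal y<x) (≤-reflexive (sym (same y<x))))

  updated-suc : ∀ {i v m₁ x} → (∀ {a} → a < n → m₁ a ≡ m₀ a) → x < entries →
    Updated i v m₁ x ⊢ block updateEntry ⟨ length updateEntry ⟩ Updated i v m₁ (suc x)
  updated-suc {i} {v} {m₁} {x} text x<N = ⊢-block updateEntry λ {r} {m} inv →
    let open Updated inv
        open Fixed fixed
        y<n = position<n i x
    in finish {r} {m} {regAfter updateEntry r m} {memAfter updateEntry r m} inv
         (pending ≤-refl x<N)
         (trans (low (<-≤-trans y<n (≤-trans (m≤m+n n k) base≤tableW))) (text y<n))
         (+-comm x 1)
         (record
           { fixed = record { n≡ = n≡ ; k≡ = k≡ ; 1≡ = 1≡ ; 2≡ = 2≡ ; ∞≡ = ∞≡ ; last≡ = last≡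
                            ; base≡ = base≡ ; 0≡ = 0≡ }
           ; i≡ = i≡ ; q≡ = q≡ ; N≡ = N≡ ; W≡ = W≡ ; A≡ = A≡ ; sa≡ = sa≡ ; sb≡ = sb≡
           ; ua≡ = ua≡ ; ub≡ = ub≡ ; ūa≡ = ūa≡ ; ūb≡ = ūb≡ })
         (updateEntry-effect {r} {m} n≡ 1≡ ∞≡ last≡ sa≡ sb≡ ua≡ ub≡ ūa≡ ūb≡ da≡ db≡ x≡ W≡ A≡ N≡ refl)
    where
    record Unchanged (r : Memory) : Set where
      field
        fixed : Fixed r
        i≡    : r $i ≡ v
        q≡    : r $q ≡ quad base (suc v)
        N≡    : r $N ≡ entries
        W≡    : r $W ≡ tableW
        A≡    : r $A ≡ tableA
        sa≡   : r $sa ≡ n ^ slot i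
        sb≡   : r $sb ≡ n ^ slot (suc i)
        ua≡   : r $ua ≡ direction (slot i)
        ub≡   : r $ub ≡ direction (slot (suc i))
        ūa≡   : r $ūa ≡ 1 ∸ direction (slot i)
        ūb≡   : r $ūb ≡ 1 ∸ direction (slot (suc i))

    finish : ∀ {r m r′ m′ w t x⁺} → Updated i v m₁ x r m →
      w ≡ table m₁ x → t ≡ m₀ (position i x) → x⁺ ≡ suc x → Unchanged r′ →
      let a  = advanced (digit (slot i) x) w (m (tableA + (x ∸ n ^ slot i)))
          w′ = t + ((1 ∸ (t ∸ a)) + (position i x ∸ position (suc i) x)) * infinite
      in r′ $best ≡ r $best ∸ (r $best ∸ w′) × r′ $x ≡ x⁺ × r′ $left ≡ entries ∸ x⁺ ×
         r′ $da ≡ ⟦ mod ⟧ (digit (slot i) x + (1 ∸ ⟦ mod ⟧ x⁺ (n ^ slot i))) n ×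
         r′ $db ≡ ⟦ mod ⟧ (digit (slot (suc i)) x + (1 ∸ ⟦ mod ⟧ x⁺ (n ^ slot (suc i)))) n ×
         m′ ≡ (m [ tableA + x ≔ a ]) [ tableW + x ≔ w′ ] →
         Updated i v m₁ (suc x) r′ m′
    finish {m = m} {r′} inv refl refl refl unchanged
        (best′≡ , x′≡ , left′≡ , da′≡ , db′≡ , refl) = record
      { fixed = fixed ; i≡ = i≡ ; q≡ = q≡ ; N≡ = N≡ ; W≡ = W≡ ; A≡ = A≡ ; sa≡ = sa≡ ; sb≡ = sb≡
      ; ua≡ = ua≡ ; ub≡ = ub≡ ; ūa≡ = ūa≡ ; ūb≡ = ūb≡
      ; x≡      = x′≡
      ; left≡   = left′≡
      ; da≡     = trans da′≡ (digit-suc (slot i) x)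
      ; db≡     = trans db′≡ (digit-suc (slot (suc i)) x)
      ; low     = λ {z} z< → trans (other (<⇒≢ (<-≤-trans z< (m≤m+n tableW x)))
                    (<⇒≢ (<-≤-trans z< (≤-trans (m≤m+n tableW entries) (m≤m+n tableA x))))) (low z<)
      ; pending = λ x<y y<N → trans (table-other y<N (>⇒≢ x<y)) (pending (<⇒≤ x<y) y<N)
      ; advance = advance′
      ; place   = place′
      ; minimum = subst (λ b → Minimum b (suc x) (table m′)) (sym best′≡)
                    (minimum-suc minimum (λ y<x → table-other (<-trans y<x x<N) (<⇒≢ y<x)) (≔-same mₐ (tableW + x) w′))
      }
      where
      open Unchanged unchanged
      open Updated inv using (low; pending; advance; place; minimum)
      a  = advanced (digit (slot i) x) (table m₁ x) (m (tableA + (x ∸ n ^ slot i)))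
      w′ = placed a (position i x) (position (suc i) x)
      mₐ = m [ tableA + x ≔ a ]
      m′ = mₐ [ tableW + x ≔ w′ ]

      other : ∀ {z} → z ≢ tableW + x → z ≢ tableA + x → m′ z ≡ m z
      other ≢W ≢A = trans (≔-other mₐ w′ ≢W) (≔-other m a ≢A)

      W<A : ∀ {y z} → y < entries → tableW + y < tableA + z
      W<A {y} {z} y<N = <-≤-trans (+-monoʳ-< tableW y<N) (m≤m+n tableA z)

      table-other : ∀ {y} → y < entries → y ≢ x → table m′ y ≡ table m y
      table-other y<N y≢x = other (λ eq → y≢x (+-cancelˡ-≡ tableW _ _ eq)) (<⇒≢ (W<A y<N))

      A-other : ∀ {y} → y ≢ x → m′ (tableA + y) ≡ m (tableA + y)
      A-other y≢x = other (>⇒≢ (W<A x<N)) (λ eq → y≢x (+-cancelˡ-≡ tableA _ _ eq))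

      A-new : m′ (tableA + x) ≡ a
      A-new = trans (≔-other mₐ w′ (>⇒≢ (W<A x<N))) (≔-same m (tableA + x) a)

      advance-new : advanced (digit (slot i) x) (table m₁ x) (m (tableA + (x ∸ n ^ slot i))) ≡
                    advanced (digit (slot i) x) (table m₁ x) (m′ (tableA + (x ∸ n ^ slot i)))
      advance-new with x ∸ n ^ slot i ≟ x
      ... | no ≢x = cong (advanced (digit (slot i) x) (table m₁ x)) (sym (A-other ≢x))
      -- The cell read is the cell written only for `x` equal to 0, by truncation; the digit is 0
      -- there, and `advanced` gives `p` the factor 0.
      ... | yes ≡x = subst (λ d → advanced d (table m₁ x) p ≡ advanced d (table m₁ x) p′) (sym digit≡0) refl
        where
        p  = m (tableA + (x ∸ n ^ slot i))
        p′ = m′ (tableA + (x ∸ n ^ slot i))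
        x≡0 : ∀ x → x ∸ n ^ slot i ≡ x → x ≡ 0
        x≡0 zero    _  = refl
        x≡0 (suc x) eq = contradiction eq
          (<⇒≢ (s≤s (≤-trans (∸-monoʳ-≤ (suc x) (>-nonZero⁻¹ (n ^ slot i) {{m^n≢0 n (slot i)}})) ≤-refl)))
        digit≡0 : digit (slot i) x ≡ 0
        digit≡0 = trans (cong (digit (slot i)) (x≡0 x ≡x)) (digit-of-0 (slot i))

      advance′ : ∀ {y} → y < suc x → m′ (tableA + y) ≡
                 advanced (digit (slot i) y) (table m₁ y) (m′ (tableA + (y ∸ n ^ slot i)))
      advance′ {y} y<1+x with y ≟ x
      ... | yes refl = trans A-new advance-new
      ... | no y≢x   = trans (A-other y≢x) (trans (advance y<x)
        (cong (advanced (digit (slot i) y) (table m₁ y))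
          (sym (A-other (<⇒≢ (≤-<-trans (m∸n≤m y (n ^ slot i)) y<x))))))
        where y<x = ≤∧≢⇒< (s≤s⁻¹ y<1+x) y≢x

      place′ : ∀ {y} → y < suc x → table m′ y ≡ placed (m′ (tableA + y)) (position i y) (position (suc i) y)
      place′ {y} y<1+x with y ≟ x
      ... | yes refl = trans (≔-same mₐ (tableW + x) w′)
        (cong (λ a → placed a (position i x) (position (suc i) x)) (sym A-new))
      ... | no y≢x = trans (table-other (<-trans y<x x<N) y≢x) (trans (place y<x)
        (cong (λ a → placed a (position i y) (position (suc i) y)) (sym (A-other y≢x))))
        where y<x = ≤∧≢⇒< (s≤s⁻¹ y<1+x) y≢x

  updated-zero : ∀ {i v m₁} → i < k → P i ≡ suc v →
    (λ r m → Searched v r m × m ≡ m₁) ⊢ block beginElement ⟨ length beginElement ⟩ Updated i v m₁ 0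
  updated-zero {i} {v} {m₁} i<k Pi≡1+v = ⊢-block beginElement λ { {r} {m} (inv , refl) →
    let open Searched inv
        open Fixed fixed
        open Params (params i<k)
        next : r $q + 4 ≡ quad base (P i)
        next = trans (cong (_+ 4) q≡) (trans (quad-suc base v) (cong (quad base) (sym Pi≡1+v)))
        next₁ = cong₂ _+_ next 1≡
        next₂ = cong₂ _+_ next₁ 1≡
        next₃ = cong₂ _+_ next₂ 1≡
        ua≡ = trans (cong m next₂) direction₁
        ub≡ = trans (cong m next₃) direction₂
        best≡ : r $∞ ∸ r $0 ≡ n + 1
        best≡ = cong₂ _∸_ ∞≡ 0≡
    in record
      { fixed = record { n≡ = n≡ ; k≡ = k≡ ; 1≡ = 1≡ ; 2≡ = 2≡ ; ∞≡ = ∞≡ ; last≡ = last≡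
                       ; base≡ = base≡ ; 0≡ = 0≡ }
      ; i≡ = i≡
      ; q≡ = trans next (cong (quad base) Pi≡1+v)
      ; N≡ = N≡
      ; W≡ = W≡
      ; A≡ = A≡
      ; sa≡ = trans (cong m next) stride₁
      ; sb≡ = trans (cong m next₁) stride₂
      ; ua≡ = ua≡
      ; ub≡ = ub≡
      ; ūa≡ = cong₂ _∸_ 1≡ ua≡
      ; ūb≡ = cong₂ _∸_ 1≡ ub≡
      ; x≡ = refl
      ; left≡ = N≡
      ; da≡ = sym (digit-of-0 (slot i))
      ; db≡ = sym (digit-of-0 (slot (suc i)))
      ; low = λ _ → refl
      ; pending = λ _ _ → refl
      ; advance = λ ()
      ; place = λ ()
      ; minimum = record
        { attained = λ ≤n → contradiction (subst (_≤ n) best≡ ≤n) (<⇒≱ (n<n+1 n))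
        ; minimal  = λ () }
      } }

  searched-after-update : ∀ {i v r₁ m₁} → i < k → P i ≡ suc v → Searched v r₁ m₁ →
    Updated i v m₁ entries ⊢ block endElement ⟨ length endElement ⟩ Searched (suc v)
  searched-after-update {i} {v} {r₁} {m₁} i<k Pi≡1+v before = ⊢-block endElement λ {r} {m} inv →
    let open Updated inv
        open Fixed fixed
        placement = record { advance = advance ; place = place }
        i′≡ = trans (cong₂ _+_ i≡ 1≡) (+-comm v 1)
    in record
      { fixed = record { n≡ = n≡ ; k≡ = k≡ ; 1≡ = 1≡ ; 2≡ = 2≡ ; ∞≡ = ∞≡ ; last≡ = last≡
                       ; base≡ = base≡ ; 0≡ = 0≡ }
      ; i≡ = i′≡
      ; todo≡ = cong₂ _∸_ k≡ i′≡
      ; q≡ = q≡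
      ; N≡ = N≡
      ; W≡ = W≡
      ; A≡ = A≡
      ; minimum = minimum
      ; text = λ a<n → trans (low (<-≤-trans a<n (≤-trans (m≤m+n n k) base≤tableW))) (Searched.text before a<n)
      ; params = λ {j} j<k → Params-cong
          (λ _ y≤ → low (≤-<-trans y≤ (quad-< base (subst (P j <_) (+-comm 1 k) (s≤s (pattern≤k j<k))))))
          (Searched.params before j<k)
      ; sound = sound-step injective i<k Pi≡1+v placement (Searched.sound before)
      ; complete = λ g embeds → Completeness.complete-step g embeds text>0 text≤n i<k Pi≡1+v placement
                                  (Searched.complete before g embeds)
      }

  elementTime : ℕ
  elementTime = length beginElement + (entries * (2 + length updateEntry) + 1 + length endElement)

  -- The loop walks through the records by value and does not compute the position `i`; surjectivity
  -- of the pattern supplies it to the proof.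
  searched-suc : ∀ {v} → v < k →
    Searched v ⊢ block beginElement ⨾ while $left (block updateEntry) ⨾ block endElement ⟨ elementTime ⟩
    Searched (suc v)
  searched-suc {v} v<k with surjective v<k
  ... | i , i<k , Pi≡1+v = triple λ {r} {m} inv → establish
    (⊢-⨾ (updated-zero i<k Pi≡1+v)
      (⊢-⨾ (⊢-while {Updated i v m} entries Updated.left≡ (updated-suc (Searched.text inv)))
           (searched-after-update i<k Pi≡1+v inv)))
    (inv , refl)

  Answer : Memory → Memory → Set
  Answer r m = (r $n ≡ 1 × ∃[ g ] Embeds n k m₀ P g) ⊎ (r $n ≡ 0 × ¬ (∃[ g ] Embeds n k m₀ P g))

  answered : Searched k ⊢ block answer ⟨ length answer ⟩ Answer
  answered = ⊢-block answer λ {r} {m} inv →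
    let open Searched inv
        open Fixed fixed
    in decide (cong₂ (λ a b → a ∸ (r $best ∸ b)) 1≡ n≡) minimum sound complete
    where
    decide : ∀ {b a f} → a ≡ 1 ∸ (b ∸ n) → Minimum b entries f → Sound k f →
      (∀ g (embeds : Embeds n k m₀ P g) → Completeness.Complete g embeds text>0 text≤n k f) →
      (a ≡ 1 × ∃[ g ] Embeds n k m₀ P g) ⊎ (a ≡ 0 × ¬ (∃[ g ] Embeds n k m₀ P g))
    decide {b} a≡ minimum sound complete with b ≤? n
    ... | yes b≤n = inj₁ (trans a≡ (cong (1 ∸_) (m≤n⇒m∸n≡0 b≤n)) ,
      (let x , x<N , fx≤n = Minimum.attained minimum b≤n in sound-end pattern≤k sound x<N fx≤n))
    ... | no b≰n = inj₂ (trans a≡ (m≤n⇒m∸n≡0 (m<n⇒0<n∸m (≰⇒> b≰n))) , λ { (g , embeds) →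
      let x , x<N , fx≤n = Completeness.complete-end g embeds text>0 text≤n (complete g embeds)
      in  b≰n (≤-trans (Minimum.minimal minimum x<N) fx≤n) })

  time : ℕ
  time = length initialise + (k * (2 + length analyseElement) + 1 +
    (length prepareTables + (k * (2 + elementTime) + 1 + length answer)))

  program-correct : Start ⊢ program ⟨ time ⟩ Answer
  program-correct =
    ⊢-⨾ analysed-zero
    (⊢-⨾ (⊢-while {Analysed} k Analysed.todo≡ analysed-suc)
    (⊢-⨾ searched-zero
    (⊢-⨾ (⊢-while {Searched} k Searched.todo≡ searched-suc) answered)))

  time-bound : time ≤ timeFactor * (k * entries)
  time-bound = begin
    time                                 ≡⟨ expand a b c d e f g k entries ⟩
    α + β * k + γ * (k * entries)        ≤⟨ +-monoˡ-≤ _ (+-mono-≤ (m≤m*n α K {{>-nonZero 1≤K}}) (*-monoʳ-≤ β k≤K)) ⟩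
    α * K + β * K + γ * K                ≡⟨ cong (_+ γ * K) (*-distribʳ-+ K α β) ⟨
    (α + β) * K + γ * K                  ≡⟨ *-distribʳ-+ K (α + β) γ ⟨
    (α + β + γ) * K                      ∎
    where
    open ≤-Reasoning
    a = length initialise
    b = length analyseElement
    c = length prepareTables
    d = length beginElement
    e = length updateEntry
    f = length endElement
    g = length answer
    K = k * entries
    α = a + 1 + c + 1 + g
    β = 2 + b + (2 + d + 1 + f)
    γ = 2 + e
    k≤K : k ≤ K
    k≤K = m≤m*n k entries {{m^n≢0 n digits}}
    1≤K : 1 ≤ K
    1≤K = ≤-trans 0<k k≤K
    expand : ∀ a b c d e f g k N →
      a + (k * (2 + b) + 1 + (c + (k * (2 + (d + (N * (2 + e) + 1 + f))) + 1 + g))) ≡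
      (a + 1 + c + 1 + g) + (2 + b + (2 + d + 1 + f)) * k + (2 + e) * (k * N)
    expand = solve-∀

-- Matchings, local extrema and the input

at : List ℕ → ℕ → ℕ
at xs a = fromMaybe 0 (head (drop a xs))

at-tabulate : ∀ {m} (f : Fin m → ℕ) ys i → at (tabulate f ++ ys) (toℕ i) ≡ f i
at-tabulate f ys zero    = refl
at-tabulate f ys (suc i) = at-tabulate (f ∘ suc) ys i

at-tabulate-+ : ∀ {m} (f : Fin m → ℕ) ys j → at (tabulate f ++ ys) (m + j) ≡ at ys j
at-tabulate-+ {zero}  f ys j = refl
at-tabulate-+ {suc m} f ys j = at-tabulate-+ (f ∘ suc) ys j

at-[] : ∀ a → at [] a ≡ 0
at-[] zero    = refl
at-[] (suc a) = refl

module _ {A : Set} where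

  -- The sublist derivation itself records which indices are kept; a skipped entry shifts all of
  -- them by one.
  ⊆-tabulate : ∀ {k n} (h : Fin k → A) (f : Fin n → A) → tabulate h ⊆ tabulate f →
               ∃[ e ] (e Preserves Fin._<_ ⟶ Fin._<_) × (∀ i → f (e i) ≡ h i)
  ⊆-tabulate {zero}          h f _ = (λ ()) , (λ { {()} }) , λ ()
  ⊆-tabulate {suc k} {suc n} h f (_ ∷ʳ h⊆f) with ⊆-tabulate h (f ∘ suc) h⊆f
  ... | e , e-mono , e-eq = suc ∘ e , s≤s ∘ e-mono , e-eq
  ⊆-tabulate {suc k} {suc n} h f (eq ∷ h⊆f) with ⊆-tabulate (h ∘ suc) (f ∘ suc) h⊆f
  ... | e , e-mono , e-eq = e⁺ , (λ {i} {j} → mono {i} {j}) , λ { zero → sym eq ; (suc i) → e-eq i }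
    where
    e⁺ : Fin (suc k) → Fin (suc n)
    e⁺ zero    = zero
    e⁺ (suc i) = suc (e i)
    mono : e⁺ Preserves Fin._<_ ⟶ Fin._<_
    mono {zero}  {suc j} _         = s≤s z≤n
    mono {suc i} {suc j} (s≤s i<j) = s≤s (e-mono i<j)

  private
    predecessor : ∀ {n} (x : Fin (suc n)) → 0 < toℕ x → ∃[ y ] x ≡ suc y
    predecessor (suc y) _ = y , refl

  -- Whether index 0 of `f` is used or skipped, monotonicity makes all remaining indices positive,
  -- so they can be lowered by one for the tail.
  tabulate-⊆ : ∀ {k n} (f : Fin n → A) (e : Fin k → Fin n) → e Preserves Fin._<_ ⟶ Fin._<_ →
               tabulate (f ∘ e) ⊆ tabulate f
  tabulate-⊆ {zero}          f e mono = []⊆ _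
  tabulate-⊆ {suc k} {zero}  f e mono with () ← e zero
  tabulate-⊆ {suc k} {suc n} f e mono with e zero in eq
  ... | zero = refl ∷ subst (_⊆ tabulate (f ∘ suc)) (tabulate-cong λ i → cong f (sym (proj₂ (below i))))
        (tabulate-⊆ (f ∘ suc) (proj₁ ∘ below) λ {i} {j} i<j →
          s≤s⁻¹ (subst₂ Fin._<_ (proj₂ (below i)) (proj₂ (below j)) (mono (s≤s i<j))))
    where
    below : ∀ i → ∃[ y ] e (suc i) ≡ suc y
    below i = predecessor (e (suc i)) (≤-<-trans z≤n (mono {zero} {suc i} (s≤s z≤n)))
  ... | suc y = f zero ∷ʳ subst (_⊆ tabulate (f ∘ suc))
        (cong₂ _∷_ (cong f (trans (sym (proj₂ (below zero))) eq))
                   (tabulate-cong λ i → cong f (sym (proj₂ (below (suc i))))))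
        (tabulate-⊆ (f ∘ suc) (proj₁ ∘ below) λ {i} {j} i<j →
          s≤s⁻¹ (subst₂ Fin._<_ (proj₂ (below i)) (proj₂ (below j)) (mono i<j)))
    where
    below : ∀ i → ∃[ y ] e i ≡ suc y
    below zero    = predecessor (e zero) (subst (λ x → 0 < toℕ x) (sym eq) (s≤s z≤n))
    below (suc i) = predecessor (e (suc i)) (≤-<-trans z≤n (mono {zero} {suc i} (s≤s z≤n)))

extended : ∀ {n k} → (Fin k → Fin n) → ℕ → ℕ
extended {k = k} h i with i <? k
... | yes i<k = toℕ (h (fromℕ< i<k))
... | no _    = 0

extended-< : ∀ {n k} (h : Fin k → Fin n) {i} (i<k : i < k) → extended h i ≡ toℕ (h (fromℕ< i<k))
extended-< {k = k} h {i} i<k with i <? k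
... | yes i<k′ = cong (toℕ ∘ h) (Fin.fromℕ<-cong i i refl i<k′ i<k)
... | no i≮k   = contradiction i<k i≮k

Lists : ∀ {m} → (ℕ → ℕ) → Permutation′ m → Set
Lists f π = ∀ i → f (toℕ i) ≡ suc (toℕ (π ⟨$⟩ʳ i))

module _ {n k T P} {text pattern′ : ℕ → ℕ} (text≡ : Lists {n} text T) (pattern≡ : Lists {k} pattern′ P) where

  embeds⇒matching : ∀ {g} → Embeds n k text pattern′ g → ∃[ M ] IsMatching T P M
  embeds⇒matching {g} embeds = M , record
    { increasing  = λ {u} {v} → increasing′ {u} {v}
    ; subsequence = subst (_⊆ sequence T) (sym M∘P) (tabulate-⊆ (T ⟨$⟩ʳ_) e λ {i} {j} → e-mono {i} {j})
    }
    where
    open Embeds embeds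
    e : Fin k → Fin n
    e i = fromℕ< (bound (Fin.toℕ<n i))
    toℕ-e : ∀ i → toℕ (e i) ≡ g (toℕ i)
    toℕ-e i = Fin.toℕ-fromℕ< (bound (Fin.toℕ<n i))
    M : Fin k → Fin n
    -- A matching acts on values, an embedding on positions; the inverse of `P` passes from one to
    -- the other.
    M v = T ⟨$⟩ʳ e (P ⟨$⟩ˡ v)
    text-e : ∀ i → text (g (toℕ i)) ≡ suc (toℕ (T ⟨$⟩ʳ e i))
    text-e i = trans (cong text (sym (toℕ-e i))) (text≡ (e i))
    pattern-P⁻¹ : ∀ v → pattern′ (toℕ (P ⟨$⟩ˡ v)) ≡ suc (toℕ v)
    pattern-P⁻¹ v = trans (pattern≡ (P ⟨$⟩ˡ v)) (cong (suc ∘ toℕ) (inverseʳ P))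
    increasing′ : M Preserves Fin._<_ ⟶ Fin._<_
    increasing′ {u} {v} u<v = s≤s⁻¹ (subst₂ _<_ (text-e (P ⟨$⟩ˡ u)) (text-e (P ⟨$⟩ˡ v))
      (monotone (Fin.toℕ<n _) (Fin.toℕ<n _) (subst₂ _<_ (sym (pattern-P⁻¹ u)) (sym (pattern-P⁻¹ v)) (s≤s u<v))))
    M∘P : map M (sequence P) ≡ tabulate (λ i → T ⟨$⟩ʳ e i)
    M∘P = trans (map-tabulate (P ⟨$⟩ʳ_) M) (tabulate-cong λ i → cong (λ j → T ⟨$⟩ʳ e j) (inverseˡ P))
    e-mono : e Preserves Fin._<_ ⟶ Fin._<_
    e-mono {i} {j} i<j = subst₂ _<_ (sym (toℕ-e i)) (sym (toℕ-e j)) (increasing embeds i<j (Fin.toℕ<n j))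

  matching⇒embeds : ∃[ M ] IsMatching T P M → ∃[ g ] Embeds n k text pattern′ g
  matching⇒embeds (M , isMatching)
    with ⊆-tabulate (λ i → M (P ⟨$⟩ʳ i)) (T ⟨$⟩ʳ_)
           (subst (_⊆ sequence T) (map-tabulate (P ⟨$⟩ʳ_) M) (IsMatching.subsequence isMatching))
  ... | e , e-mono , e-eq = extended e , record
    { bound     = λ i<k → subst (_< n) (sym (extended-< e i<k)) (Fin.toℕ<n _)
    ; ascending = λ {i} 1+i<k → let i<k = <-trans (n<1+n i) 1+i<k in
        subst₂ _<_ (sym (extended-< e i<k)) (sym (extended-< e 1+i<k))
          (e-mono (subst₂ _<_ (sym (Fin.toℕ-fromℕ< i<k)) (sym (Fin.toℕ-fromℕ< 1+i<k)) (n<1+n i)))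
    ; monotone  = λ i<k j<k lt → subst₂ _<_ (sym (text-e i<k)) (sym (text-e j<k))
        (s≤s (IsMatching.increasing isMatching
          (s≤s⁻¹ (subst₂ _<_ (pattern-< i<k) (pattern-< j<k) lt))))
    }
    where
    pattern-< : ∀ {i} (i<k : i < k) → pattern′ i ≡ suc (toℕ (P ⟨$⟩ʳ fromℕ< i<k))
    pattern-< i<k = trans (cong pattern′ (sym (Fin.toℕ-fromℕ< i<k))) (pattern≡ (fromℕ< i<k))
    text-e : ∀ {i} (i<k : i < k) → text (extended e i) ≡ suc (toℕ (M (P ⟨$⟩ʳ fromℕ< i<k)))
    text-e i<k = trans (cong text (extended-< e i<k))
      (trans (text≡ (e (fromℕ< i<k))) (cong (suc ∘ toℕ) (e-eq (fromℕ< i<k))))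

-- Slots and local extrema

length-filter-∷ : ∀ {A : Set} {Q : Pred A 0ℓ} (Q? : Decidable Q) x xs →
                  length (filter Q? xs) ≤ length (filter Q? (x ∷ xs))
length-filter-∷ Q? x xs with Q? x
... | yes _ = n≤1+n _
... | no _  = ≤-refl

module _ {k P} {Q : Pred (Fin k) 0ℓ} (Q? : Decidable Q)
         (last : ∀ {i l} → toℕ i ≡ suc l → suc (toℕ i) ≡ k → Q i)
         (turns : ∀ {i l} → toℕ i ≡ suc l → suc (toℕ i) < k → Slots.turn k P (suc l) ≡ 1 → Q i) where

  open Slots k P

  -- From `suc l` on, every position where the slot number rises satisfies `Q`, and so does the last
  -- one, where it does not rise; this yields the extra 1 on the left.
  slot≤count : ∀ m {l} (f : Fin (suc m) → Fin k) → (∀ i → toℕ (f i) ≡ suc l + toℕ i) → suc l + suc m ≡ k →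
    suc (slot k) ≤ slot (suc l) + length (filter Q? (tabulate f))
  slot≤count zero {l} f f≡ end = subst₂ (λ a b → suc a ≤ slot (suc l) + b)
      (trans (sym (slot-last (≤-reflexive (sym end′)))) (cong slot end′))
      (sym (cong length (filter-accept Q? {xs = []}
        (last f0≡ (trans (cong suc f0≡) end′)))))
      (≤-reflexive (+-comm 1 (slot (suc l))))
    where
    f0≡ : toℕ (f zero) ≡ suc l
    f0≡ = trans (f≡ zero) (+-identityʳ (suc l))
    end′ : suc (suc l) ≡ k
    end′ = trans (+-comm 1 (suc l)) end
  slot≤count (suc m) {l} f f≡ end = ≤-trans
    (slot≤count m (f ∘ suc) (λ i → trans (f≡ (suc i)) (+-suc (suc l) (toℕ i))) (trans (sym (+-suc (suc l) (suc m))) end))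
    (≤-trans (≤-reflexive (+-assoc (slot (suc l)) e (length (filter Q? rest))))
      (+-monoʳ-≤ (slot (suc l)) here))
    where
    e    = turn (suc l)
    rest = tabulate (f ∘ suc)
    f0≡ : toℕ (f zero) ≡ suc l
    f0≡ = trans (f≡ zero) (+-identityʳ (suc l))
    1+f0<k : suc (toℕ (f zero)) < k
    1+f0<k = subst₂ _<_ (cong suc (sym f0≡)) end
      (≤-trans (s≤s (s≤s (≤-reflexive (+-comm 1 l)))) (≤-trans (+-monoʳ-≤ (suc (suc l)) (s≤s (z≤n {m})))
        (≤-reflexive (sym (+-suc (suc l) (suc m))))))
    here : e + length (filter Q? rest) ≤ length (filter Q? (f zero ∷ rest))
    here with change-isBit (direction (slot (suc l))) (suc l)
    ... | inj₁ e≡0 = subst (λ x → x + length (filter Q? rest) ≤ length (filter Q? (f zero ∷ rest))) (sym e≡0) (length-filter-∷ Q? (f zero) rest)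
    ... | inj₂ e≡1 = subst (λ x → x + length (filter Q? rest) ≤ length (filter Q? (f zero ∷ rest))) (sym e≡1)
      (≤-reflexive (sym (cong length (filter-accept Q? {xs = rest} (turns f0≡ 1+f0<k e≡1)))))

-- The first and the last position count for `Q` without a change of slot, which accounts for the 2.
-- At the first, this is because `direction 0` agrees with the first edge.
slot<count : ∀ {m} P {Q : Pred (Fin (2 + m)) 0ℓ} (Q? : Decidable Q) → Q zero →
  (∀ {i l} → toℕ i ≡ suc l → suc (toℕ i) ≡ 2 + m → Q i) →
  (∀ {i l} → toℕ i ≡ suc l → suc (toℕ i) < 2 + m → Slots.turn (2 + m) P (suc l) ≡ 1 → Q i) →
  2 + Slots.slot (2 + m) P (2 + m) ≤ length (filter Q? (allFin (2 + m)))
slot<count {m} P Q? first last turns = ≤-trans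
  (s≤s (≤-trans (slot≤count Q? last turns m suc (λ _ → refl) refl)
    (≤-reflexive (cong (_+ length (filter Q? (tabulate suc))) slot-1))))
  (≤-reflexive (sym (cong length (filter-accept Q? {xs = tabulate suc} first))))
  where
  open Slots (2 + m) P
  no-turn : ∀ {b} → IsBit b → ((b + 0) % 2 + b) % 2 ≡ 0
  no-turn (inj₁ refl) = refl
  no-turn (inj₂ refl) = refl
  slot-1 : slot 1 ≡ 0
  slot-1 = trans (change-inner {direction 0} (s≤s (s≤s z≤n))) (no-turn (rising-isBit 0))

module _ {k} (π : Permutation′ k) {P : ℕ → ℕ} (P≡ : Lists P π) where

  open Slots k P

  step-up : ∀ {i j : Fin k} → toℕ j ≡ suc (toℕ i) → rising (toℕ i) ≡ 1 → (π ⟨$⟩ʳ i) Fin.< (π ⟨$⟩ʳ j)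
  step-up {i} {j} j≡1+i up = s≤s⁻¹ (subst₂ _<_ (P≡ i) (trans (cong P (sym j≡1+i)) (P≡ j)) (rising≡1⇒< up))

  step-down : ∀ {i j : Fin k} → toℕ j ≡ suc (toℕ i) → rising (toℕ i) ≡ 0 → (π ⟨$⟩ʳ j) Fin.< (π ⟨$⟩ʳ i)
  step-down {i} {j} j≡1+i down = ≤∧≢⇒<
    (s≤s⁻¹ (subst₂ _≤_ (trans (cong P (sym j≡1+i)) (P≡ j)) (P≡ i) (rising≡0⇒≥ down)))
    λ eq → 1+n≢n (trans (sym j≡1+i)
      (cong toℕ (Injection.injective (↔⇒↣ π) (Fin.toℕ-injective eq))))

  first-extremum : ∀ {i : Fin k} → toℕ i ≡ 0 → LocalExtremum π i
  first-extremum {i} i≡0 with rising-isBit (toℕ i)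
  ... | inj₁ down = inj₂ λ
    { j (inj₁ j≡1+i) → step-down j≡1+i down ; j (inj₂ i≡1+j) → contradiction (trans (sym i≡0) i≡1+j) λ () }
  ... | inj₂ up = inj₁ λ
    { j (inj₁ j≡1+i) → step-up j≡1+i up ; j (inj₂ i≡1+j) → contradiction (trans (sym i≡0) i≡1+j) λ () }

  last-extremum : ∀ {i : Fin k} {l} → toℕ i ≡ suc l → suc (toℕ i) ≡ k → LocalExtremum π i
  last-extremum {i} {l} i≡1+l 1+i≡k with rising-isBit l
  ... | inj₁ down = inj₁ λ
    { j (inj₁ j≡1+i) → contradiction (trans j≡1+i 1+i≡k) (<⇒≢ (Fin.toℕ<n j))
    ; j (inj₂ i≡1+j) → step-down i≡1+j (subst (λ x → rising x ≡ 0) (suc-injective (trans (sym i≡1+l) i≡1+j)) down) }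
  ... | inj₂ up = inj₂ λ
    { j (inj₁ j≡1+i) → contradiction (trans j≡1+i 1+i≡k) (<⇒≢ (Fin.toℕ<n j))
    ; j (inj₂ i≡1+j) → step-up i≡1+j (subst (λ x → rising x ≡ 1) (suc-injective (trans (sym i≡1+l) i≡1+j)) up) }

  -- By `direction-slot` the current direction is that of the left edge, so a turn means that the
  -- two edges differ: up then down is a peak, down then up a valley.
  turn-extremum : ∀ {i : Fin k} {l} → toℕ i ≡ suc l → suc (toℕ i) < k →
                  turn (suc l) ≡ 1 → LocalExtremum π i
  turn-extremum {i} {l} i≡1+l 1+i<k turn≡1
    with rising-isBit l | rising-isBit (suc l) |
         trans (sym (trans (change-inner {direction (slot (suc l))} 2+l<k)
           (cong (λ d → (d + rising (suc l)) % 2) (direction-slot 1+l<k)))) turn≡1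
    where
    2+l<k = subst (λ x → suc x < k) i≡1+l 1+i<k
    1+l<k = <-trans (n<1+n (suc l)) 2+l<k
  ... | inj₁ down | inj₁ down′ | odd = 0≢1 (cong₂ (λ a b → (a + b) % 2) down down′) odd
  ... | inj₂ up   | inj₂ up′   | odd = 0≢1 (cong₂ (λ a b → (a + b) % 2) up up′) odd
  ... | inj₁ down | inj₂ up    | _ = inj₁ λ
    { j (inj₁ j≡1+i) → step-up j≡1+i (subst (λ x → rising x ≡ 1) (sym i≡1+l) up)
    ; j (inj₂ i≡1+j) → step-down i≡1+j (subst (λ x → rising x ≡ 0) (suc-injective (trans (sym i≡1+l) i≡1+j)) down) }
  ... | inj₂ up   | inj₁ down  | _ = inj₂ λ
    { j (inj₁ j≡1+i) → step-down j≡1+i (subst (λ x → rising x ≡ 0) (sym i≡1+l) down)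
    ; j (inj₂ i≡1+j) → step-up i≡1+j (subst (λ x → rising x ≡ 1) (suc-injective (trans (sym i≡1+l) i≡1+j)) up) }

-- The factor `k` is absorbed by one factor `n`, and the number of digits is at most `run π`. A
-- pattern of length 1 has no run but still one digit; there the factor `k` is 1 and the spare `n`
-- pays for the digit.
runs-bound : ∀ {n k} .{{_ : NonZero n}} (π : Permutation′ k) {P : ℕ → ℕ} → Lists P π → 1 ≤ k → k ≤ n →
             k * n ^ suc (Slots.slot k P k) ≤ n ^ (1 + run π)
runs-bound {n} {suc zero} π {P} P≡ _ _ = ≤-reflexive (trans (*-identityˡ _)
  (cong (λ j → n ^ suc j) (Slots.slot-last 1 P ≤-refl)))
runs-bound {n} {suc (suc m)} π {P} P≡ _ k≤n = *-mono-≤ k≤n (^-monoʳ-≤ n (s≤s⁻¹ (≤-trans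
  (slot<count P (localExtremum? π) (first-extremum π {P} P≡ refl) (last-extremum π {P} P≡) (turn-extremum π {P} P≡))
  (≤-reflexive (sym (run-localExtrema π))))))

-- The memory of an instance and the final bound

module Instance (I : PPMInstance) where
  open PPMInstance I

  m₀ : Memory
  m₀ = mem (input I)

  textValue : Fin n → ℕ
  textValue i = suc (toℕ (T ⟨$⟩ʳ i))

  patternValue : Fin k → ℕ
  patternValue i = suc (toℕ (P ⟨$⟩ʳ i))

  m₀≡ : ∀ a → m₀ a ≡ at (tabulate textValue ++ tabulate patternValue ++ []) a
  m₀≡ a = cong (λ xs → at xs a) (cong₂ _++_ (map-tabulate (T ⟨$⟩ʳ_) (suc ∘ toℕ))
    -- The empty tail gives the pattern the shape that `at-tabulate` expects.
    (trans (map-tabulate (P ⟨$⟩ʳ_) (suc ∘ toℕ)) (sym (++-identityʳ _))))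

  text≡ : Lists {n} m₀ T
  text≡ i = trans (m₀≡ (toℕ i)) (at-tabulate textValue _ i)

  pattern≡ : Lists {k} (λ i → m₀ (n + i)) P
  pattern≡ i = trans (m₀≡ (n + toℕ i))
    (trans (at-tabulate-+ textValue _ (toℕ i)) (at-tabulate patternValue [] i))

  rest≡0 : ∀ {a} → n + k ≤ a → m₀ a ≡ 0
  rest≡0 {a} ≤a = trans (cong m₀ (trans (sym (m+[n∸m]≡n ≤a)) (+-assoc n k _)))
    (trans (m₀≡ (n + (k + (a ∸ (n + k)))))
      (trans (at-tabulate-+ textValue _ (k + (a ∸ (n + k))))
        (trans (at-tabulate-+ patternValue [] (a ∸ (n + k))) (at-[] (a ∸ (n + k))))))

  text-< : ∀ {y} (y<n : y < n) → m₀ y ≡ textValue (fromℕ< y<n)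
  text-< y<n = trans (cong m₀ (sym (Fin.toℕ-fromℕ< y<n))) (text≡ (fromℕ< y<n))

  pattern-< : ∀ {i} (i<k : i < k) → m₀ (n + i) ≡ patternValue (fromℕ< i<k)
  pattern-< i<k = trans (cong (λ i → m₀ (n + i)) (sym (Fin.toℕ-fromℕ< i<k))) (pattern≡ (fromℕ< i<k))

  injective : ∀ {i j} → i < k → j < k → m₀ (n + i) ≡ m₀ (n + j) → i ≡ j
  injective i<k j<k eq = trans (sym (Fin.toℕ-fromℕ< i<k)) (trans
    (cong toℕ (Injection.injective (↔⇒↣ P) (Fin.toℕ-injective (suc-injective
      (trans (sym (pattern-< i<k)) (trans eq (pattern-< j<k)))))))
    (Fin.toℕ-fromℕ< j<k))

  surjective : ∀ {v} → v < k → ∃[ i ] i < k × m₀ (n + i) ≡ suc v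
  surjective v<k = toℕ i , Fin.toℕ<n i , trans (pattern≡ i)
    (cong suc (trans (cong toℕ (inverseʳ P)) (Fin.toℕ-fromℕ< v<k)))
    where i = P ⟨$⟩ˡ fromℕ< v<k

  instance
    n≢0 : NonZero n
    n≢0 = >-nonZero (≤-trans 1≤k k≤n)

  open Search n k m₀ 1≤k
    (λ y<n → subst (0 <_) (sym (text-< y<n)) (s≤s z≤n))
    (λ y<n → subst (_≤ n) (sym (text-< y<n)) (Fin.toℕ<n (T ⟨$⟩ʳ fromℕ< y<n)))
    (λ i<k → subst (0 <_) (sym (pattern-< i<k)) (s≤s z≤n))
    (λ i<k → subst (_≤ k) (sym (pattern-< i<k)) (Fin.toℕ<n (P ⟨$⟩ʳ fromℕ< i<k)))
    injective surjective rest≡0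
    using (Answer; time; program-correct; time-bound)

  correct : ∀ r {m} → Answer r m → Correct I (r $n)
  correct r (inj₁ (yes≡ , _ , embeds)) = inj₁ (yes≡ , embeds⇒matching text≡ pattern≡ embeds)
  correct r (inj₂ (no≡ , ¬embeds))     = inj₂ (no≡ , ¬embeds ∘ matching⇒embeds text≡ pattern≡)

  solved : SolvesWithin (compile 0 program) I (timeFactor * n ^ (1 + run P))
  solved = conclude (establish program-correct (record { n≡ = refl ; k≡ = refl ; m≡ = λ _ → refl }))
    where
    conclude : ∃[ r ] ∃[ m ] Runs program (reg (input I)) m₀ time r m × Answer r m →
               SolvesWithin (compile 0 program) I (timeFactor * n ^ (1 + run P))
    conclude (r , m , terminates , answer) =
      time + 0 , config (size program) r m
      , extendRun terminates (loaded λ i eq → eq) (halt (fetch-length (compile 0 program)))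
      , ≤-trans (≤-reflexive (+-identityʳ time))
          (≤-trans time-bound (*-monoʳ-≤ timeFactor (runs-bound P pattern≡ 1≤k k≤n)))
      , correct r {m} answer

theorem4p7 : PPMSolvableInTimeO (λ I → let open PPMInstance I in n ^ (1 + run P))
theorem4p7 = compile 0 program , timeFactor , Instance.solved
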